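{- Let $D=(V,A)$ be a finite loopless digraph, $f:A\to\mathbb{Z}\cup\{ -\infty\}$, $g:A\to\mathbb{Z}\cup\{+\infty\}$ with $f\le g$, and $B\subseteq\mathbb{R}^V$ an integral base-polyhedron such that $Q=Q(f,g;B)$ is a non-empty integral base-flow polyhedron. Let $L\subseteq A$ be a subset of edges on which both $f$ and $g$ are finite-valued. Then there exist a face $B_L$ of $B$ and bounds $f_L:A\to\mathbb{Z}\cup\{ -\infty\}$, $g_L:A\to\mathbb{Z}\cup\{+\infty\}$ with $f\le f_L\le g_L\le g$ such that an element $z\in Q\cap\mathbb{Z}^A$ is an $L$-upper-minimizer if and only if $z\in Q_L\cap\mathbb{Z}^A$, where $Q_L=Q(f_L,g_L;B_L)$.
   Context: For $x\in\mathbb{R}^V$, $\widetilde x(Z)=\sum_{v\in Z}x(v)$. A set function $p:2^V\to\mathbb{Z}\cup\{ -\infty\}$ with $p(\emptyset)=0$ is supermodular if $p(X)+p(Y)\le p(X\cap Y)+p(X\cup Y)$ for all $X,Y$. For such $p$ with $p(V)$ finite, $B'(p)=\{x\in\mathbb{R}^V:\widetilde x(V)=p(V),\ \widetilde x(Z)\ge p(Z)\ \forall Z\subset V\}$ is a base-polyhedron (integral if $p$ is integer-valued where finite). For $x:A\to\mathbb{R}$, $\psi_x(v)=\sum_{uv\in A}x(uv)-\sum_{vu\in A}x(vu)$, and $Q(f,g;B)=\{x\in\mathbb{R}^A: f\le x\le g,\ \psi_x\in B\}$. An element $z\in Q\cap\mathbb{Z}^A$ is an $L$-upper-minimizer if the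 number of edges $e\in L$ with $z(e)=g(e)$ (the $g$-saturated edges of $L$) is as small as possible among all elements of $Q\cap\mathbb{Z}^A$.
   Formalization: The base-polyhedron B, its face B_L and the base-flow polyhedra Q, Q_L are taken as sets of rational rather than real vectors, with the face given by a rational valid inequality on the rational points of B. -}

module Defs where

open import Data.Nat using (ℕ; zero; suc)
import Data.Nat as ℕ
open import Data.Integer as ℤ using (ℤ)
open import Data.Rational as ℚ using (ℚ; 0ℚ)
open import Data.Fin using (Fin; zero; suc)
import Data.Fin
open import Data.Fin.Subset using (Subset; _∩_; _∪_; _∈_; _⊂_)
import Data.Fin.Subset as Sub
open import Data.Bool using (Bool; true; false; if_then_else_)
open import Data.Vec using (lookup)
open import Data.Product using (Σ; _×_; _,_)
open import Data.Empty using (⊥)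
open import Data.Unit using (⊤)
open import Relation.Binary.PropositionalEquality using (_≡_; _≢_)
open import Relation.Nullary using (Dec; yes; no; ¬_)
open import Level using (0ℓ)
import Data.Integer.Properties as ℤP
open import Function.Bundles using (_⇔_)

data ℤ₋ : Set where
  -∞   : ℤ₋
  fin₋ : ℤ → ℤ₋

data ℤ⁺ : Set where
  fin⁺ : ℤ → ℤ⁺
  +∞   : ℤ⁺

_+₋_ : ℤ₋ → ℤ₋ → ℤ₋
-∞     +₋ _      = -∞
fin₋ a +₋ -∞     = -∞
fin₋ a +₋ fin₋ b = fin₋ (a ℤ.+ b)

data _≤₋_ : ℤ₋ → ℤ₋ → Set where
  -∞≤  : ∀ {a} → -∞ ≤₋ a
  fin≤ : ∀ {a b} → a ℤ.≤ b → fin₋ a ≤₋ fin₋ b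

data _≤⁺_ : ℤ⁺ → ℤ⁺ → Set where
  ≤+∞  : ∀ {a} → a ≤⁺ +∞
  fin≤ : ∀ {a b} → a ℤ.≤ b → fin⁺ a ≤⁺ fin⁺ b

data _≤₋⁺_ : ℤ₋ → ℤ⁺ → Set where
  -∞≤  : ∀ {a} → -∞ ≤₋⁺ a
  ≤+∞  : ∀ {a} → a ≤₋⁺ +∞
  fin≤ : ∀ {a b} → a ℤ.≤ b → fin₋ a ≤₋⁺ fin⁺ b

toℚ : ℤ → ℚ
toℚ i = i ℚ./ 1

data _≤₋ℚ_ : ℤ₋ → ℚ → Set where
  -∞≤  : ∀ {q} → -∞ ≤₋ℚ q
  fin≤ : ∀ {a q} → toℚ a ℚ.≤ q → fin₋ a ≤₋ℚ q

data _ℚ≤⁺_ : ℚ → ℤ⁺ → Set where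
  ≤+∞  : ∀ {q} → q ℚ≤⁺ +∞
  fin≤ : ∀ {q a} → q ℚ.≤ toℚ a → q ℚ≤⁺ fin⁺ a

sumℚ : ∀ {k} → (Fin k → ℚ) → ℚ
sumℚ {zero}  h = 0ℚ
sumℚ {suc k} h = h zero ℚ.+ sumℚ (λ i → h (suc i))

sumℕ : ∀ {k} → (Fin k → ℕ) → ℕ
sumℕ {zero}  h = 0
sumℕ {suc k} h = h zero ℕ.+ sumℕ (λ i → h (suc i))

x̃ : ∀ {n} → (Fin n → ℚ) → Subset n → ℚ
x̃ x Z = sumℚ (λ v → if lookup Z v then x v else 0ℚ)

_·_ : ∀ {n} → (Fin n → ℚ) → (Fin n → ℚ) → ℚ
c · y = sumℚ (λ v → c v ℚ.* y v)

record IsSupermodular {n : ℕ} (p : Subset n → ℤ₋) : Set where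
  field
    p∅    : p Sub.⊥ ≡ fin₋ (ℤ.+ 0)
    super : ∀ X Y → (p X +₋ p Y) ≤₋ (p (X ∩ Y) +₋ p (X ∪ Y))
    pV    : Σ ℤ (λ k → p Sub.⊤ ≡ fin₋ k)

data _≡₋ℚ_ : ℤ₋ → ℚ → Set where
  fin≡ : ∀ {a q} → toℚ a ≡ q → fin₋ a ≡₋ℚ q

record InB' {n : ℕ} (p : Subset n → ℤ₋) (x : Fin n → ℚ) : Set where
  field
    total : p Sub.⊤ ≡₋ℚ x̃ x Sub.⊤
    lower : ∀ Z → Z ⊂ Sub.⊤ → p Z ≤₋ℚ x̃ x Z

-- F is a face of the polyhedron B: F = {y ∈ B : c·y = δ} for a valid
-- inequality c·y ≤ δ of B (c = 0, δ = 0 gives B itself; c = 0, δ = 1 the empty face)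
IsFace : ∀ {n} → ((Fin n → ℚ) → Set) → ((Fin n → ℚ) → Set) → Set
IsFace {n} B F =
  Σ (Fin n → ℚ) λ c → Σ ℚ λ δ →
    (∀ y → B y → (c · y) ℚ.≤ δ) ×
    (∀ y → F y ⇔ (B y × (c · y) ≡ δ))

-- finite loopless digraph D = (V, A), V = Fin n, A = Fin m (parallel edges allowed);
-- edge e goes from tail e to head e
record Digraph (n m : ℕ) : Set where
  field
    tail head : Fin m → Fin n
    loopless  : ∀ e → tail e ≢ head e

open Digraph public

indicator : ∀ {n} → Fin n → Fin n → ℚ → ℚ
indicator u v q with u Data.Fin.≟ v
... | yes _ = q
... | no  _ = 0ℚ

ψ : ∀ {n m} → Digraph n m → (Fin m → ℚ) → Fin n → ℚ
ψ D x v = sumℚ (λ e → indicator (head D e) v (x e))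
          ℚ.- sumℚ (λ e → indicator (tail D e) v (x e))

InQ : ∀ {n m} → Digraph n m → (Fin m → ℤ₋) → (Fin m → ℤ⁺) →
      ((Fin n → ℚ) → Set) → (Fin m → ℚ) → Set
InQ D f g B x = (∀ e → f e ≤₋ℚ x e) × (∀ e → x e ℚ≤⁺ g e) × B (ψ D x)

InQℤ : ∀ {n m} → Digraph n m → (Fin m → ℤ₋) → (Fin m → ℤ⁺) →
       ((Fin n → ℚ) → Set) → (Fin m → ℤ) → Set
InQℤ D f g B z = InQ D f g B (λ e → toℚ (z e))

saturated : ℤ⁺ → ℤ → Bool
saturated (fin⁺ a) b with a ℤ.≟ b
... | yes _ = true
... | no  _ = false
saturated +∞ b = false

satCount : ∀ {m} → (Fin m → ℤ⁺) → Subset m → (Fin m → ℤ) → ℕ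
satCount g L z = sumℕ (λ e → if lookup L e then (if saturated (g e) (z e) then 1 else 0) else 0)

IsUpperMin : ∀ {n m} → Digraph n m → (Fin m → ℤ₋) → (Fin m → ℤ⁺) →
             ((Fin n → ℚ) → Set) → Subset m → (Fin m → ℤ) → Set
IsUpperMin D f g B L z =
  InQℤ D f g B z × (∀ w → InQℤ D f g B w → satCount g L z ℕ.≤ satCount g L w)

FiniteOn : ∀ {m} → Subset m → (Fin m → ℤ₋) → (Fin m → ℤ⁺) → Set
FiniteOn L f g = ∀ e → e ∈ L → Σ ℤ (λ a → f e ≡ fin₋ a) × Σ ℤ (λ b → g e ≡ fin⁺ b)

{-# OPTIONS --safe #-}
-- Primal-dual argument. Charging 1 for every saturated edge of L turns the count into a separable
-- convex cost, so z is a minimizer as soon as there is a potential π : V → ℕ such that every edge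
-- is optimal for its cost minus (π tail − π head) z(e), and ψ_z maximizes π over B, that is, every
-- level set {π < t} is tight for ψ_z. Such a pair cuts out all minimizers: by complementary slackness
-- these are the z whose inflow lies on the face of B maximizing π and whose entries lie, edge by
-- edge, in the interval of optimal values.
-- The pair is built by charging the edges of L one at a time, starting with π = 0. If the new edge
-- e₀ is not optimal, then it is saturated and its two ends have equal potential. Lower z(e₀) by one
-- and search from its tail for its head among the residual edges and the exchange pairs
-- (ψ_z + χ_u − χ_v ∈ B) that keep optimality for π: either one unit is rerouted along a shortest
-- path, or raising π by one on all that was reached makes z optimal again.
module Submission where

open import Defs
open import Algebra.Bundles using (AbelianGroup; CommutativeMonoid)
open import Data.Bool using (Bool; true; false; if_then_else_; _∧_; _∨_; not; T)
import Data.Bool.Properties as BoolP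
open import Data.Fin using (Fin; zero; suc; _≟_)
open import Data.Fin.Properties using (any?)
open import Data.Fin.Subset using (Subset; _∩_; _∪_; _∈_; _∉_; _⊂_; _⊃_; _⊆_; ⊤; ⊥)
open import Data.Fin.Subset.Induction using (⊃-wellFounded; Acc; acc)
open import Data.Fin.Subset.Properties
  using (_∈?_; ∈⊤; ∉⊥; ⊆⊤; ⊆-antisym; x∈p∩q⁺; x∈p∩q⁻; x∈p∪q⁺; x∈p∪q⁻; anySubset?)
open import Data.Integer as ℤ using (ℤ; +_; 0ℤ; 1ℤ)
import Data.Integer.Properties as ℤP
open import Data.Integer.Tactic.RingSolver using (solve-∀)
open import Data.Nat as ℕ using (ℕ; zero; suc)
import Data.Nat.Properties as ℕP
open import Data.Product using (Σ; _×_; _,_; ∃; proj₁; proj₂)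
open import Data.Rational as ℚ using (ℚ; 0ℚ)
import Data.Rational.Properties as ℚP
import Data.Rational.Unnormalised as ℚᵘ
import Data.Rational.Unnormalised.Properties as ℚᵘP
open import Data.Sum using (_⊎_; inj₁; inj₂; [_,_]′)
open import Data.Vec using (lookup; tabulate)
open import Data.Vec.Functional using (updateAt)
open import Data.Vec.Functional.Properties using (updateAt-updates; updateAt-minimal)
open import Data.Vec.Properties
  using (lookup-zipWith; lookup∘tabulate; lookup-replicate; lookup⇒[]=; []=⇒lookup)
open import Function using (_∘_; case_of_)
open import Function.Bundles using (_⇔_; mk⇔; Equivalence)
open import Relation.Binary using (tri<; tri≈; tri>)
open import Relation.Binary.PropositionalEquality
open import Relation.Nullary using (Dec; yes; no; ¬_; does; ¬?; _×-dec_; _⊎-dec_)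
open import Relation.Nullary.Decidable using (map′; dec-true; dec-false; decidable-stable)
open import Relation.Nullary.Negation using (contradiction)
open import Algebra.Properties.Group (AbelianGroup.group ℤP.+-0-abelianGroup)
  using (∙-cancelˡ; ∙-cancelʳ)
open import Algebra.Properties.Semiring.Sum ℤP.+-*-semiring
  using (sum; sum-cong-≗; ∑-distrib-+; ∑-comm; *-distribˡ-sum; sum-replicate-zero)
open Equivalence using (to; from)

-- Integers inside the rationals

-- `toℚ` divides out a gcd. In the unnormalised rationals the image has denominator 1, so the laws
-- below reduce to integer arithmetic.
toℚᵘ-toℚ : ∀ i → ℚ.toℚᵘ (toℚ i) ℚᵘ.≃ ℚᵘ.mkℚᵘ i 0
toℚᵘ-toℚ i = ℚP.toℚᵘ-fromℚᵘ (ℚᵘ.mkℚᵘ i 0)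

toℚ-+ : ∀ a b → toℚ (a ℤ.+ b) ≡ toℚ a ℚ.+ toℚ b
toℚ-+ a b = ℚP.toℚᵘ-injective (begin
  ℚ.toℚᵘ (toℚ (a ℤ.+ b))                    ≈⟨ toℚᵘ-toℚ (a ℤ.+ b) ⟩
  ℚᵘ.mkℚᵘ (a ℤ.+ b) 0                       ≈⟨ ℚᵘ.*≡* (solve-∀′ a b) ⟩
  ℚᵘ.mkℚᵘ a 0 ℚᵘ.+ ℚᵘ.mkℚᵘ b 0              ≈⟨ ℚᵘP.+-cong (toℚᵘ-toℚ a) (toℚᵘ-toℚ b) ⟨
  ℚ.toℚᵘ (toℚ a) ℚᵘ.+ ℚ.toℚᵘ (toℚ b)        ≈⟨ ℚP.toℚᵘ-homo-+ (toℚ a) (toℚ b) ⟨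
  ℚ.toℚᵘ (toℚ a ℚ.+ toℚ b)                  ∎)
  where
  open ℚᵘP.≃-Reasoning
  solve-∀′ : ∀ a b → (a ℤ.+ b) ℤ.* 1ℤ ≡ (a ℤ.* 1ℤ ℤ.+ b ℤ.* 1ℤ) ℤ.* 1ℤ
  solve-∀′ = solve-∀

toℚ-* : ∀ a b → toℚ (a ℤ.* b) ≡ toℚ a ℚ.* toℚ b
toℚ-* a b = ℚP.toℚᵘ-injective (begin
  ℚ.toℚᵘ (toℚ (a ℤ.* b))                    ≈⟨ toℚᵘ-toℚ (a ℤ.* b) ⟩
  ℚᵘ.mkℚᵘ a 0 ℚᵘ.* ℚᵘ.mkℚᵘ b 0              ≈⟨ ℚᵘP.*-cong (toℚᵘ-toℚ a) (toℚᵘ-toℚ b) ⟨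
  ℚ.toℚᵘ (toℚ a) ℚᵘ.* ℚ.toℚᵘ (toℚ b)        ≈⟨ ℚP.toℚᵘ-homo-* (toℚ a) (toℚ b) ⟨
  ℚ.toℚᵘ (toℚ a ℚ.* toℚ b)                  ∎)
  where open ℚᵘP.≃-Reasoning

toℚ-neg : ∀ a → toℚ (ℤ.- a) ≡ ℚ.- toℚ a
toℚ-neg a = ℚP.toℚᵘ-injective (begin
  ℚ.toℚᵘ (toℚ (ℤ.- a))       ≈⟨ toℚᵘ-toℚ (ℤ.- a) ⟩
  ℚᵘ.- ℚᵘ.mkℚᵘ a 0           ≈⟨ ℚᵘP.-‿cong (toℚᵘ-toℚ a) ⟨
  ℚᵘ.- ℚ.toℚᵘ (toℚ a)        ≈⟨ ℚP.toℚᵘ-homo‿- (toℚ a) ⟨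
  ℚ.toℚᵘ (ℚ.- toℚ a)         ∎)
  where open ℚᵘP.≃-Reasoning

toℚ-- : ∀ a b → toℚ (a ℤ.- b) ≡ toℚ a ℚ.- toℚ b
toℚ-- a b = trans (toℚ-+ a (ℤ.- b)) (cong (toℚ a ℚ.+_) (toℚ-neg b))

toℚ-mono-≤ : ∀ {a b} → a ℤ.≤ b → toℚ a ℚ.≤ toℚ b
toℚ-mono-≤ {a} {b} a≤b = ℚP.toℚᵘ-cancel-≤ (begin
  ℚ.toℚᵘ (toℚ a)  ≃⟨ toℚᵘ-toℚ a ⟩
  ℚᵘ.mkℚᵘ a 0     ≤⟨ ℚᵘ.*≤* (ℤP.*-monoʳ-≤-nonNeg 1ℤ a≤b) ⟩
  ℚᵘ.mkℚᵘ b 0     ≃⟨ toℚᵘ-toℚ b ⟨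
  ℚ.toℚᵘ (toℚ b)  ∎)
  where open ℚᵘP.≤-Reasoning

toℚ-cancel-≤ : ∀ {a b} → toℚ a ℚ.≤ toℚ b → a ℤ.≤ b
toℚ-cancel-≤ {a} {b} le = case num of λ where
    (ℚᵘ.*≤* q) → ℤP.*-cancelʳ-≤-pos a b 1ℤ q
  where
  open ℚᵘP.≤-Reasoning
  num : ℚᵘ.mkℚᵘ a 0 ℚᵘ.≤ ℚᵘ.mkℚᵘ b 0
  num = begin
    ℚᵘ.mkℚᵘ a 0     ≃⟨ toℚᵘ-toℚ a ⟨
    ℚ.toℚᵘ (toℚ a)  ≤⟨ ℚP.toℚᵘ-mono-≤ le ⟩
    ℚ.toℚᵘ (toℚ b)  ≃⟨ toℚᵘ-toℚ b ⟩
    ℚᵘ.mkℚᵘ b 0     ∎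

toℚ-injective : ∀ {a b} → toℚ a ≡ toℚ b → a ≡ b
toℚ-injective eq = ℤP.≤-antisym (toℚ-cancel-≤ (ℚP.≤-reflexive eq))
                                (toℚ-cancel-≤ (ℚP.≤-reflexive (sym eq)))

-- Finite sums

sumℚ-cong : ∀ {k} {g h : Fin k → ℚ} → g ≗ h → sumℚ g ≡ sumℚ h
sumℚ-cong {zero}  eq = refl
sumℚ-cong {suc k} eq = cong₂ ℚ._+_ (eq zero) (sumℚ-cong (eq ∘ suc))

sumℚ-distrib-+ : ∀ {k} (g h : Fin k → ℚ) → sumℚ (λ i → g i ℚ.+ h i) ≡ sumℚ g ℚ.+ sumℚ h
sumℚ-distrib-+ {zero}  g h = sym (ℚP.+-identityˡ 0ℚ)
sumℚ-distrib-+ {suc k} g h =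
  trans (cong (g zero ℚ.+ h zero ℚ.+_) (sumℚ-distrib-+ (g ∘ suc) (h ∘ suc)))
        (interchange (g zero) (h zero) (sumℚ (g ∘ suc)) (sumℚ (h ∘ suc)))
  where
  open import Algebra.Properties.CommutativeSemigroup
    (CommutativeMonoid.commutativeSemigroup ℚP.+-0-commutativeMonoid) using (interchange)

sumℚ-toℚ : ∀ {k} (h : Fin k → ℤ) → sumℚ (toℚ ∘ h) ≡ toℚ (sum h)
sumℚ-toℚ {zero}  h = refl
sumℚ-toℚ {suc k} h = trans (cong (toℚ (h zero) ℚ.+_) (sumℚ-toℚ (h ∘ suc)))
                           (sym (toℚ-+ (h zero) (sum (h ∘ suc))))

+sumℕ : ∀ {k} (h : Fin k → ℕ) → + sumℕ h ≡ sum (λ i → + h i)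
+sumℕ {zero}  h = refl
+sumℕ {suc k} h = cong (ℤ._+_ (+ h zero)) (+sumℕ (h ∘ suc))

sum-mono-≤ : ∀ {k} {g h : Fin k → ℤ} → (∀ i → g i ℤ.≤ h i) → sum g ℤ.≤ sum h
sum-mono-≤ {zero}  le = ℤP.≤-refl
sum-mono-≤ {suc k} le = ℤP.+-mono-≤ (le zero) (sum-mono-≤ (le ∘ suc))

-- A single strict term would make the whole sum strict. This equality case is what complementary
-- slackness rests on.
sum-≤⇒≗ : ∀ {k} {g h : Fin k → ℤ} → (∀ i → g i ℤ.≤ h i) → sum h ℤ.≤ sum g → g ≗ h
sum-≤⇒≗ {suc k} {g} {h} le ge zero    = ℤP.≤-antisym (le zero)
  (ℤP.≮⇒≥ λ lt → ℤP.<⇒≱ (ℤP.+-mono-<-≤ lt (sum-mono-≤ (le ∘ suc))) ge)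
sum-≤⇒≗ {suc k} {g} {h} le ge (suc i) = sum-≤⇒≗ (le ∘ suc)
  (ℤP.≮⇒≥ λ lt → ℤP.<⇒≱ (ℤP.+-mono-≤-< (le zero) lt) ge) i

sum-neg : ∀ {k} (h : Fin k → ℤ) → sum (λ i → ℤ.- h i) ≡ ℤ.- sum h
sum-neg {zero}  h = refl
sum-neg {suc k} h = trans (cong (ℤ._+_ (ℤ.- h zero)) (sum-neg (h ∘ suc)))
                          (sym (ℤP.neg-distrib-+ (h zero) (sum (h ∘ suc))))

sum-distrib-- : ∀ {k} (g h : Fin k → ℤ) → sum (λ i → g i ℤ.- h i) ≡ sum g ℤ.- sum h
sum-distrib-- g h = trans (∑-distrib-+ g (λ i → ℤ.- h i)) (cong (ℤ._+_ (sum g)) (sum-neg h))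

sum-update : ∀ {k} {g h : Fin k → ℤ} j → (∀ i → i ≢ j → h i ≡ g i) →
             sum h ≡ sum g ℤ.+ (h j ℤ.- g j)
sum-update {suc k} {g} {h} zero eq = trans
  (cong (ℤ._+_ (h zero)) (sum-cong-≗ (λ i → eq (suc i) λ ())))
  (rearrange (g zero) (h zero) (sum (g ∘ suc)))
  where
  rearrange : ∀ a b c → b ℤ.+ c ≡ (a ℤ.+ c) ℤ.+ (b ℤ.- a)
  rearrange = solve-∀
sum-update {suc k} {g} {h} (suc j) eq = trans
  (cong₂ ℤ._+_ (eq zero λ ()) (sum-update j λ i i≢j → eq (suc i) λ { refl → i≢j refl }))
  (sym (ℤP.+-assoc (g zero) _ _))

-- Abel summation: π · y = Σ_{k ≥ 1} y ({π ≥ k}).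
dot-mono-upper : ∀ {n} (N : ℕ) (π : Fin n → ℕ) (y y′ : Fin n → ℚ) → (∀ v → π v ℕ.≤ N) →
  (∀ k → sumℚ (λ v → if k ℕ.<ᵇ π v then y v else 0ℚ) ℚ.≤
         sumℚ (λ v → if k ℕ.<ᵇ π v then y′ v else 0ℚ)) →
  (λ v → toℚ (+ π v)) · y ℚ.≤ (λ v → toℚ (+ π v)) · y′
dot-mono-upper zero π y y′ bound le = ℚP.≤-reflexive (sumℚ-cong λ v →
  trans (zeros v y) (sym (zeros v y′)))
  where
  zeros : ∀ v (y : Fin _ → ℚ) → toℚ (+ π v) ℚ.* y v ≡ 0ℚ
  zeros v y = trans (cong (λ a → toℚ (+ a) ℚ.* y v) (ℕP.n≤0⇒n≡0 (bound v))) (ℚP.*-zeroˡ (y v))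
-- The layer π ≥ 1 is split off; passing to `pred ∘ π` shifts each remaining layer down by one.
dot-mono-upper (suc N) π y y′ bound le = subst₂ ℚ._≤_ (sym (split y)) (sym (split y′))
  (ℚP.+-mono-≤ (le 0) (dot-mono-upper N (ℕ.pred ∘ π) y y′
    (λ v → ℕP.pred-mono-≤ (bound v))
    (λ k → subst₂ ℚ._≤_ (sumℚ-cong (shift y k)) (sumℚ-cong (shift y′ k)) (le (suc k)))))
  where
  shift : ∀ (y : Fin _ → ℚ) k v → (if suc k ℕ.<ᵇ π v then y v else 0ℚ) ≡
                                (if k ℕ.<ᵇ ℕ.pred (π v) then y v else 0ℚ)
  shift y k v with π v
  ... | zero  = refl
  ... | suc _ = refl
  layer : ∀ a (q : ℚ) → toℚ (+ a) ℚ.* q ≡ (if 0 ℕ.<ᵇ a then q else 0ℚ) ℚ.+ toℚ (+ ℕ.pred a) ℚ.* q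
  layer zero    q = sym (ℚP.+-identityˡ _)
  layer (suc a) q = trans (cong (ℚ._* q) (toℚ-+ 1ℤ (+ a))) (trans (ℚP.*-distribʳ-+ q (toℚ 1ℤ) (toℚ (+ a)))
                      (cong (ℚ._+ toℚ (+ a) ℚ.* q) (ℚP.*-identityˡ q)))
  split : ∀ y → (λ v → toℚ (+ π v)) · y ≡
          sumℚ (λ v → if 0 ℕ.<ᵇ π v then y v else 0ℚ) ℚ.+ (λ v → toℚ (+ ℕ.pred (π v))) · y
  split y = trans (sumℚ-cong λ v → layer (π v) (y v)) (sumℚ-distrib-+ (λ v → if 0 ℕ.<ᵇ π v then y v else 0ℚ)
                                 (λ v → toℚ (+ ℕ.pred (π v)) ℚ.* y v))

bounded : ∀ {k} (h : Fin k → ℕ) → ∃ λ N → ∀ i → h i ℕ.≤ N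
bounded {zero}  h = 0 , λ ()
bounded {suc k} h with bounded (h ∘ suc)
... | N , le = h zero ℕ.⊔ N , λ where
  zero    → ℕP.m≤m⊔n (h zero) N
  (suc i) → ℕP.≤-trans (le i) (ℕP.m≤n⊔m (h zero) N)

-- Base polyhedra, tight sets and exchanges

-- Integer counterpart of `x̃`: tight sets and exchanges are handled over ℤ, where a strict
-- inequality leaves a whole unit of slack.
σ : ∀ {n} → (Fin n → ℤ) → Subset n → ℤ
σ y Z = sum (λ v → if lookup Z v then y v else 0ℤ)

∉⇒lookup : ∀ {n} {v : Fin n} {X} → v ∉ X → lookup X v ≡ false
∉⇒lookup {v = v} {X} v∉X = BoolP.¬-not (v∉X ∘ lookup⇒[]= v X)

lookup⇒∉ : ∀ {n} {v : Fin n} {X} → lookup X v ≡ false → v ∉ X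
lookup⇒∉ eq v∈X = case trans (sym eq) ([]=⇒lookup v∈X) of λ ()

≡⊤⊎⊂⊤ : ∀ {n} (Z : Subset n) → Z ≡ ⊤ ⊎ Z ⊂ ⊤
≡⊤⊎⊂⊤ Z with any? (λ v → ¬? (v ∈? Z))
... | yes (v , v∉Z) = inj₂ (⊆⊤ , v , ∈⊤ , v∉Z)
... | no  none      = inj₁ (⊆-antisym ⊆⊤ λ {v} _ → decidable-stable (v ∈? Z) λ v∉Z → none (v , v∉Z))

σ-cong : ∀ {n} {y y′ : Fin n → ℤ} → y ≗ y′ → σ y ≗ σ y′
σ-cong eq Z = sum-cong-≗ λ v → cong (if lookup Z v then_else 0ℤ) (eq v)

x̃-toℚ : ∀ {n} (y : Fin n → ℤ) Z → x̃ (toℚ ∘ y) Z ≡ toℚ (σ y Z)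
x̃-toℚ y Z = trans (sumℚ-cong λ v → cell (lookup Z v) (y v)) (sumℚ-toℚ λ v → if lookup Z v then y v else 0ℤ)
  where
  cell : ∀ b a → (if b then toℚ a else 0ℚ) ≡ toℚ (if b then a else 0ℤ)
  cell true  a = refl
  cell false a = refl

σ-modular : ∀ {n} (y : Fin n → ℤ) X Y → σ y X ℤ.+ σ y Y ≡ σ y (X ∩ Y) ℤ.+ σ y (X ∪ Y)
σ-modular y X Y = begin
  σ y X ℤ.+ σ y Y              ≡⟨ ∑-distrib-+ (part X) (part Y) ⟨
  sum (λ v → part X v ℤ.+ part Y v)
    ≡⟨ sum-cong-≗ (λ v → trans (cell (lookup X v) (lookup Y v) (y v))
         (cong₂ (λ a b → (if a then y v else 0ℤ) ℤ.+ (if b then y v else 0ℤ))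
           (sym (lookup-zipWith _∧_ v X Y)) (sym (lookup-zipWith _∨_ v X Y)))) ⟩
  sum (λ v → part (X ∩ Y) v ℤ.+ part (X ∪ Y) v) ≡⟨ ∑-distrib-+ (part (X ∩ Y)) (part (X ∪ Y)) ⟩
  σ y (X ∩ Y) ℤ.+ σ y (X ∪ Y)  ∎
  where
  open ≡-Reasoning
  part : Subset _ → Fin _ → ℤ
  part Z v = if lookup Z v then y v else 0ℤ
  cell : ∀ a b (q : ℤ) → (if a then q else 0ℤ) ℤ.+ (if b then q else 0ℤ) ≡
         (if a ∧ b then q else 0ℤ) ℤ.+ (if a ∨ b then q else 0ℤ)
  cell true  b     q = ℤP.+-comm q _
  cell false true  q = refl
  cell false false q = refl

σ-⊥ : ∀ {n} (y : Fin n → ℤ) → σ y ⊥ ≡ 0ℤ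
σ-⊥ {n} y = trans (sum-cong-≗ λ v → cong (if_then y v else 0ℤ) (lookup-replicate v false)) (sum-replicate-zero n)

δ : ∀ {n} → Fin n → Fin n → ℤ
δ u w = if does (u ≟ w) then 1ℤ else 0ℤ

⟦_∈_⟧ : ∀ {n} → Fin n → Subset n → ℤ
⟦ u ∈ Z ⟧ = if lookup Z u then 1ℤ else 0ℤ

σ-δ : ∀ {n} (u : Fin n) Z → σ (δ u) Z ≡ ⟦ u ∈ Z ⟧
σ-δ {n} u Z = begin
  σ (δ u) Z                             ≡⟨ sum-update {g = λ _ → 0ℤ} u off ⟩
  sum {n} (λ _ → 0ℤ) ℤ.+ (on ℤ.- 0ℤ)    ≡⟨ cong₂ (λ a b → a ℤ.+ (b ℤ.- 0ℤ)) (sum-replicate-zero n) at ⟩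
  0ℤ ℤ.+ (⟦ u ∈ Z ⟧ ℤ.- 0ℤ)             ≡⟨ trans (ℤP.+-identityˡ _) (ℤP.+-identityʳ _) ⟩
  ⟦ u ∈ Z ⟧                             ∎
  where
  open ≡-Reasoning
  on = if lookup Z u then δ u u else 0ℤ
  at : on ≡ ⟦ u ∈ Z ⟧
  at = cong (λ b → if lookup Z u then (if b then 1ℤ else 0ℤ) else 0ℤ) (dec-true (u ≟ u) refl)
  off : ∀ w → w ≢ u → (if lookup Z w then δ u w else 0ℤ) ≡ 0ℤ
  off w w≢u with lookup Z w
  ... | false = refl
  ... | true  = cong (if_then 1ℤ else 0ℤ) (dec-false (u ≟ w) (w≢u ∘ sym))

exchange : ∀ {n} → (Fin n → ℤ) → Fin n → Fin n → Fin n → ℤ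
exchange y u v w = y w ℤ.+ (δ u w ℤ.- δ v w)

σ-exchange : ∀ {n} (y : Fin n → ℤ) u v Z →
             σ (exchange y u v) Z ≡ σ y Z ℤ.+ (⟦ u ∈ Z ⟧ ℤ.- ⟦ v ∈ Z ⟧)
σ-exchange y u v Z = begin
  σ (exchange y u v) Z                      ≡⟨ sum-cong-≗ (λ w → cell (lookup Z w) (y w) (δ u w) (δ v w)) ⟩
  sum (λ w → part y w ℤ.+ (part (δ u) w ℤ.- part (δ v) w))
                                            ≡⟨ ∑-distrib-+ (part y) (λ w → part (δ u) w ℤ.- part (δ v) w) ⟩
  σ y Z ℤ.+ sum (λ w → part (δ u) w ℤ.- part (δ v) w)
                                            ≡⟨ cong (ℤ._+_ (σ y Z)) (sum-distrib-- (part (δ u)) (part (δ v))) ⟩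
  σ y Z ℤ.+ (σ (δ u) Z ℤ.- σ (δ v) Z)       ≡⟨ cong₂ (λ a b → σ y Z ℤ.+ (a ℤ.- b)) (σ-δ u Z) (σ-δ v Z) ⟩
  σ y Z ℤ.+ (⟦ u ∈ Z ⟧ ℤ.- ⟦ v ∈ Z ⟧)       ∎
  where
  open ≡-Reasoning
  part : (Fin _ → ℤ) → Fin _ → ℤ
  part h w = if lookup Z w then h w else 0ℤ
  cell : ∀ b p q r → (if b then p ℤ.+ (q ℤ.- r) else 0ℤ) ≡
         (if b then p else 0ℤ) ℤ.+ ((if b then q else 0ℤ) ℤ.- (if b then r else 0ℤ))
  cell true  p q r = refl
  cell false p q r = refl

σ-exchange-≡ : ∀ {n} (y : Fin n → ℤ) u v Z → lookup Z u ≡ lookup Z v → σ (exchange y u v) Z ≡ σ y Z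
σ-exchange-≡ y u v Z eq = begin
  σ (exchange y u v) Z                 ≡⟨ σ-exchange y u v Z ⟩
  σ y Z ℤ.+ (⟦ u ∈ Z ⟧ ℤ.- ⟦ v ∈ Z ⟧)  ≡⟨ cong (λ b → σ y Z ℤ.+ ((if b then 1ℤ else 0ℤ) ℤ.- ⟦ v ∈ Z ⟧)) eq ⟩
  σ y Z ℤ.+ (⟦ v ∈ Z ⟧ ℤ.- ⟦ v ∈ Z ⟧)  ≡⟨ cong (ℤ._+_ (σ y Z)) (ℤP.+-inverseʳ ⟦ v ∈ Z ⟧) ⟩
  σ y Z ℤ.+ 0ℤ                         ≡⟨ ℤP.+-identityʳ _ ⟩
  σ y Z                                ∎
  where open ≡-Reasoning

-- Order on the extended integers

fin₋-injective : ∀ {a b} → fin₋ a ≡ fin₋ b → a ≡ b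
fin₋-injective refl = refl

≤₋-refl : ∀ {a} → a ≤₋ a
≤₋-refl { -∞ }   = -∞≤
≤₋-refl {fin₋ a} = fin≤ ℤP.≤-refl

≤₋-trans : ∀ {a b c} → a ≤₋ b → b ≤₋ c → a ≤₋ c
≤₋-trans -∞≤      _        = -∞≤
≤₋-trans (fin≤ p) (fin≤ q) = fin≤ (ℤP.≤-trans p q)

≤⁺-trans : ∀ {a b c} → a ≤⁺ b → b ≤⁺ c → a ≤⁺ c
≤⁺-trans _        ≤+∞      = ≤+∞
≤⁺-trans (fin≤ p) (fin≤ q) = fin≤ (ℤP.≤-trans p q)

≤⁺-refl : ∀ {a} → a ≤⁺ a
≤⁺-refl {+∞}     = ≤+∞
≤⁺-refl {fin⁺ _} = fin≤ ℤP.≤-refl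

infix 4 _≟₋_ _≤₋?_ _≤⁺?_

_≟₋_ : (a b : ℤ₋) → Dec (a ≡ b)
-∞     ≟₋ -∞     = yes refl
-∞     ≟₋ fin₋ _ = no λ ()
fin₋ _ ≟₋ -∞     = no λ ()
fin₋ a ≟₋ fin₋ b with a ℤ.≟ b
... | yes refl = yes refl
... | no  a≢b  = no (a≢b ∘ fin₋-injective)

_≤₋?_ : (a b : ℤ₋) → Dec (a ≤₋ b)
-∞     ≤₋? _      = yes -∞≤
fin₋ _ ≤₋? -∞     = no λ ()
fin₋ a ≤₋? fin₋ b with a ℤ.≤? b
... | yes p = yes (fin≤ p)
... | no ¬p = no λ { (fin≤ p) → ¬p p }

_≤⁺?_ : (a b : ℤ⁺) → Dec (a ≤⁺ b)
_      ≤⁺? +∞     = yes ≤+∞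
+∞     ≤⁺? fin⁺ _ = no λ ()
fin⁺ a ≤⁺? fin⁺ b with a ℤ.≤? b
... | yes p = yes (fin≤ p)
... | no ¬p = no λ { (fin≤ p) → ¬p p }

-- Equality case for uncrossing: the upper bounds leave no slack in the sum, hence none in either
-- summand, and a summand -∞ would make the sum -∞.
+₋-cancel-≤ : ∀ {a b i j} → a ≤₋ fin₋ i → b ≤₋ fin₋ j → fin₋ (i ℤ.+ j) ≤₋ (a +₋ b) →
              a ≡ fin₋ i × b ≡ fin₋ j
+₋-cancel-≤ -∞≤ _ ()
+₋-cancel-≤ (fin≤ _) -∞≤ ()
+₋-cancel-≤ {fin₋ a} {fin₋ b} {i} {j} (fin≤ a≤i) (fin≤ b≤j) (fin≤ le) =
  cong fin₋ (ℤP.≤-antisym a≤i (ℤP.≮⇒≥ λ a<i → ℤP.<⇒≱ (ℤP.+-mono-<-≤ a<i b≤j) le)) ,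
  cong fin₋ (ℤP.≤-antisym b≤j (ℤP.≮⇒≥ λ b<j → ℤP.<⇒≱ (ℤP.+-mono-≤-< a≤i b<j) le))

-- Lower level sets are used because `B'` bounds sums from below: a base vector maximizing π carries
-- as little as possible where π is small. Applied to search labels, the same sets collect the
-- vertices reached.
below : ∀ {n} → (Fin n → ℕ) → ℕ → Subset n
below π t = tabulate (λ v → π v ℕ.<ᵇ t)

module _ {n} (π : Fin n → ℕ) {t : ℕ} {v : Fin n} where

  ∈below⁺ : π v ℕ.< t → v ∈ below π t
  ∈below⁺ lt = lookup⇒[]= v _ (trans (lookup∘tabulate _ v) (dec-true (π v ℕ.<? t) lt))

  ∈below⁻ : v ∈ below π t → π v ℕ.< t
  ∈below⁻ v∈ = ℕP.<ᵇ⇒< (π v) t (subst T (trans (sym ([]=⇒lookup v∈)) (lookup∘tabulate _ v)) _)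

raise : ∀ {n} → (Fin n → ℕ) → Subset n → Fin n → ℕ
raise π R v = if lookup R v then suc (π v) else π v

-- `InB'` bounds proper subsets only; on the whole vertex set the bound comes from the equation for
-- the total.
lower-all : ∀ {n} {p : Subset n → ℤ₋} {x} → InB' p x → ∀ Z → p Z ≤₋ℚ x̃ x Z
lower-all {p = p} b Z with ≡⊤⊎⊂⊤ Z
... | inj₂ Z⊂⊤ = InB'.lower b Z Z⊂⊤
... | inj₁ refl with p ⊤ | InB'.total b
...   | fin₋ a | fin≡ eq = fin≤ (ℚP.≤-reflexive eq)

module Base {n} (p : Subset n → ℤ₋) (supermodular : IsSupermodular p) where
  open IsSupermodular supermodular

  record InBase (y : Fin n → ℤ) : Set where
    field
      total : p ⊤ ≡ fin₋ (σ y ⊤)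
      lower : ∀ Z → p Z ≤₋ fin₋ (σ y Z)

  module _ {y : Fin n → ℤ} {x : Fin n → ℚ} (x≗y : x ≗ toℚ ∘ y) where

    x̃≡σ : ∀ Z → x̃ x Z ≡ toℚ (σ y Z)
    x̃≡σ Z = trans (sumℚ-cong λ v → cong (if lookup Z v then_else 0ℚ) (x≗y v)) (x̃-toℚ y Z)

    fromB' : InB' p x → InBase y
    fromB' x∈B = record { total = tot (InB'.total x∈B) ; lower = λ Z → low Z (lower-all x∈B Z) }
      where
      tot : ∀ {a} → a ≡₋ℚ x̃ x ⊤ → a ≡ fin₋ (σ y ⊤)
      tot (fin≡ eq) = cong fin₋ (toℚ-injective (trans eq (x̃≡σ ⊤)))
      low : ∀ {a} Z → a ≤₋ℚ x̃ x Z → a ≤₋ fin₋ (σ y Z)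
      low Z -∞≤      = -∞≤
      low Z (fin≤ q) = fin≤ (toℚ-cancel-≤ (subst (_ ℚ.≤_) (x̃≡σ Z) q))

    toB' : InBase y → InB' p x
    toB' b = record
      { total = subst (_≡₋ℚ x̃ x ⊤) (sym (InBase.total b)) (fin≡ (sym (x̃≡σ ⊤)))
      ; lower = λ Z _ → low Z (InBase.lower b Z) }
      where
      low : ∀ {a} Z → a ≤₋ fin₋ (σ y Z) → a ≤₋ℚ x̃ x Z
      low Z -∞≤      = -∞≤
      low Z (fin≤ q) = fin≤ (subst (_ ℚ.≤_) (sym (x̃≡σ Z)) (toℚ-mono-≤ q))

  Tight : (Fin n → ℤ) → Subset n → Set
  Tight y X = p X ≡ fin₋ (σ y X)

  Levels : (Fin n → ℕ) → (Fin n → ℤ) → Set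
  Levels π y = ∀ t → Tight y (below π t)

  -- For y in the base polyhedron, Sep y v u means that y + χ_u − χ_v is not in it.
  Sep : (Fin n → ℤ) → Fin n → Fin n → Set
  Sep y v u = ∃ λ X → Tight y X × v ∈ X × u ∉ X

  sep? : ∀ y v u → Dec (Sep y v u)
  sep? y v u = anySubset? λ X → (p X ≟₋ fin₋ (σ y X)) ×-dec (v ∈? X) ×-dec ¬? (u ∈? X)

  InBase-resp-≗ : ∀ {y y′} → y ≗ y′ → InBase y → InBase y′
  InBase-resp-≗ eq b = record
    { total = trans (InBase.total b) (cong fin₋ (σ-cong eq ⊤))
    ; lower = λ Z → subst (λ s → p Z ≤₋ fin₋ s) (σ-cong eq Z) (InBase.lower b Z)
    }

  Levels-resp-≗ : ∀ {π y y′} → y ≗ y′ → Levels π y → Levels π y′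
  Levels-resp-≗ {π} eq lev t = trans (lev t) (cong fin₋ (σ-cong eq (below π t)))

  module _ {y : Fin n → ℤ} (b : InBase y) where

    -- Supermodularity of p against modularity of `σ y`: the sum of the two p-values is at least the
    -- sum of their upper bounds, so both bounds are attained.
    tight-∩∪ : ∀ {X Y} → Tight y X → Tight y Y → Tight y (X ∩ Y) × Tight y (X ∪ Y)
    tight-∩∪ {X} {Y} tX tY = +₋-cancel-≤ (InBase.lower b (X ∩ Y)) (InBase.lower b (X ∪ Y))
      (subst (_≤₋ (p (X ∩ Y) +₋ p (X ∪ Y)))
             (trans (cong₂ _+₋_ tX tY) (cong fin₋ (σ-modular y X Y)))
             (super X Y))

    tight-⊥ : Tight y ⊥
    tight-⊥ = trans p∅ (cong fin₋ (sym (σ-⊥ y)))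

    -- S is the union over v in S of the intersection over u outside S of tight sets separating v
    -- from u, and tight sets form a lattice. `meet` starts from ⊤ and `join` from ⊥, both tight.
    separated⇒tight : ∀ S → (∀ v u → v ∈ S → u ∉ S → Sep y v u) → Tight y S
    separated⇒tight S sep =
      let X , tX , X⊆S , S⊆X = join n (λ v → v) in
      subst (Tight y) (⊆-antisym X⊆S λ {v} v∈S → [ contradiction v∈S , (λ v∈X → v∈X) ]′ (S⊆X v)) tX
      where
      meet : ∀ v → v ∈ S → ∀ k (us : Fin k → Fin n) →
             ∃ λ X → Tight y X × v ∈ X × (∀ i → us i ∈ S ⊎ us i ∉ X)
      meet v v∈S zero    us = ⊤ , InBase.total b , ∈⊤ , λ ()
      meet v v∈S (suc k) us with meet v v∈S k (us ∘ suc) | us zero ∈? S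
      ... | X , tX , v∈X , out | yes u∈S = X , tX , v∈X , λ { zero → inj₁ u∈S ; (suc i) → out i }
      ... | X , tX , v∈X , out | no  u∉S =
        let Y , tY , v∈Y , u∉Y = sep v (us zero) v∈S u∉S in
        X ∩ Y , proj₁ (tight-∩∪ tX tY) , x∈p∩q⁺ (v∈X , v∈Y) , λ where
          zero    → inj₂ (u∉Y ∘ proj₂ ∘ x∈p∩q⁻ X Y)
          (suc i) → case out i of λ where
            (inj₁ u∈S) → inj₁ u∈S
            (inj₂ u∉X) → inj₂ (u∉X ∘ proj₁ ∘ x∈p∩q⁻ X Y)
      join : ∀ k (vs : Fin k → Fin n) →
             ∃ λ X → Tight y X × X ⊆ S × (∀ i → vs i ∉ S ⊎ vs i ∈ X)
      join zero    vs = ⊥ , tight-⊥ , (λ v∈⊥ → contradiction v∈⊥ ∉⊥) , λ ()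
      join (suc k) vs with join k (vs ∘ suc) | vs zero ∈? S
      ... | X , tX , X⊆S , inn | no  v∉S = X , tX , X⊆S , λ { zero → inj₁ v∉S ; (suc i) → inn i }
      ... | X , tX , X⊆S , inn | yes v∈S =
        let Y , tY , v∈Y , out = meet (vs zero) v∈S n (λ u → u)
            Y⊆S : Y ⊆ S
            Y⊆S {u} u∈Y = [ (λ u∈S → u∈S) , contradiction u∈Y ]′ (out u) in
        X ∪ Y , proj₂ (tight-∩∪ tX tY) , (λ u∈ → [ X⊆S , Y⊆S ]′ (x∈p∪q⁻ X Y u∈)) , λ where
          zero    → inj₂ (x∈p∪q⁺ (inj₂ v∈Y))
          (suc i) → case inn i of λ where
            (inj₁ v∉S) → inj₁ v∉S
            (inj₂ v∈X) → inj₂ (x∈p∪q⁺ (inj₁ v∈X))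

    -- Let v lie inside a new level set and u outside. If π v < π u, an old level set separates
    -- them. Otherwise raising has broken a tie, so u is in R, v is not, and the closure hypothesis
    -- applies.
    levels-raise : ∀ {π R} → Levels π y →
      (∀ u v → u ∈ R → v ∉ R → π u ≡ π v → Sep y v u) → Levels (raise π R) y
    levels-raise {π} {R} lev closed t = separated⇒tight _ sep
      where
      sep : ∀ v u → v ∈ below (raise π R) t → u ∉ below (raise π R) t → Sep y v u
      sep v u v∈ u∉ with π v ℕ.<? π u
      ... | yes v<u = below π (π u) , lev (π u) , ∈below⁺ π v<u , λ u∈ → ℕP.<-irrefl refl (∈below⁻ π u∈)
      ... | no  v≮u with ℕP.<-≤-trans (∈below⁻ (raise π R) v∈) (ℕP.≮⇒≥ (u∉ ∘ ∈below⁺ (raise π R) {t}))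
      ...   | lt with lookup R v in eqv | lookup R u in equ
      ...     | true  | true  = contradiction (ℕ.s<s⁻¹ lt) v≮u
      ...     | true  | false = contradiction (ℕP.<-trans (ℕP.n<1+n _) lt) v≮u
      ...     | false | false = contradiction lt v≮u
      ...     | false | true  = closed u v (lookup⇒[]= u R equ) (lookup⇒∉ eqv)
                                  (ℕP.≤-antisym (ℕP.≮⇒≥ v≮u) (ℕ.s≤s⁻¹ lt))

    -- Only sets containing v but not u lose a unit. None of these is tight, so by integrality each
    -- has a unit to spare.
    exchange-base : ∀ {u v} → ¬ Sep y v u → InBase (exchange y u v)
    exchange-base {u} {v} ¬sep = record
      { total = trans (InBase.total b) (cong fin₋ (sym (σ-exchange-≡ y u v ⊤
          (trans ([]=⇒lookup {i = u} ∈⊤) (sym ([]=⇒lookup {i = v} ∈⊤))))))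
      ; lower = λ Z → low Z (InBase.lower b Z)
      }
      where
      low : ∀ Z → p Z ≤₋ fin₋ (σ y Z) → p Z ≤₋ fin₋ (σ (exchange y u v) Z)
      low Z le rewrite σ-exchange y u v Z with lookup Z u in equ | lookup Z v in eqv
      ... | true  | true  = subst (λ s → p Z ≤₋ fin₋ s) (sym (ℤP.+-identityʳ _)) le
      ... | false | false = subst (λ s → p Z ≤₋ fin₋ s) (sym (ℤP.+-identityʳ _)) le
      ... | true  | false = ≤₋-trans le (fin≤ (ℤP.i≤i+j (σ y Z) 1ℤ))
      ... | false | true  = strict le (λ tight → ¬sep (Z , tight , lookup⇒[]= v Z eqv , lookup⇒∉ equ))
        where
        strict : ∀ {a i} → a ≤₋ fin₋ i → a ≢ fin₋ i → a ≤₋ fin₋ (i ℤ.+ (0ℤ ℤ.- 1ℤ))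
        strict -∞≤ _ = -∞≤
        strict {fin₋ a} {i} (fin≤ a≤i) a≢i = fin≤ (subst (a ℤ.≤_) (ℤP.+-comm (ℤ.- 1ℤ) i)
          (ℤP.i<j⇒i≤pred[j] (ℤP.≤∧≢⇒< a≤i (a≢i ∘ cong fin₋))))

  tight-exchange⁺ : ∀ {y u v X} → lookup X u ≡ lookup X v → Tight y X → Tight (exchange y u v) X
  tight-exchange⁺ {y} {u} {v} {X} eq t = trans t (cong fin₋ (sym (σ-exchange-≡ y u v X eq)))

  tight-exchange⁻ : ∀ {y u v X} → lookup X u ≡ lookup X v → Tight (exchange y u v) X → Tight y X
  tight-exchange⁻ {y} {u} {v} {X} eq t = trans t (cong fin₋ (σ-exchange-≡ y u v X eq))

  levels-exchange : ∀ {y π u v} → π u ≡ π v → Levels π y → Levels π (exchange y u v)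
  levels-exchange {π = π} {u} {v} eq lev t = tight-exchange⁺
    (trans (lookup∘tabulate _ u) (trans (cong (ℕ._<ᵇ t) eq) (sym (lookup∘tabulate _ v)))) (lev t)

  -- Exchange pairs unaffected by an earlier exchange

  module _ {u v v′ w : Fin n} where

    -- Intersecting with a set of the first kind, or uniting with one of the second,
    -- turns any set separating v′ from w into one whose y-value an exchange at u and v keeps.
    Anchor : (Fin n → ℤ) → Set
    Anchor y = (∃ λ S → Tight y S × v′ ∈ S × u ∉ S × v ∉ S)
             ⊎ (∃ λ S → Tight y S × w ∉ S × u ∈ S × v ∈ S)

    confine : ∀ {y} → InBase y → Anchor y → Sep y v′ w →
              ∃ λ X → Tight y X × v′ ∈ X × w ∉ X × lookup X u ≡ lookup X v
    confine b (inj₁ (S , tS , v′∈S , u∉S , v∉S)) (X , tX , v′∈X , w∉X) =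
      X ∩ S , proj₁ (tight-∩∪ b tX tS) , x∈p∩q⁺ (v′∈X , v′∈S) , w∉X ∘ proj₁ ∘ x∈p∩q⁻ X S ,
      trans (∉⇒lookup (u∉S ∘ proj₂ ∘ x∈p∩q⁻ X S)) (sym (∉⇒lookup (v∉S ∘ proj₂ ∘ x∈p∩q⁻ X S)))
    confine b (inj₂ (S , tS , w∉S , u∈S , v∈S)) (X , tX , v′∈X , w∉X) =
      X ∪ S , proj₂ (tight-∩∪ b tX tS) , x∈p∪q⁺ (inj₁ v′∈X) , [ w∉X , w∉S ]′ ∘ x∈p∪q⁻ X S ,
      trans ([]=⇒lookup (x∈p∪q⁺ {p = X} (inj₂ u∈S))) (sym ([]=⇒lookup (x∈p∪q⁺ {p = X} (inj₂ v∈S))))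

    -- If π v′ < π u, the level set below π u works. On a tie, a tight set separating v′ from u also
    -- misses v, since otherwise it would separate v from u. If π v′ > π u, the level set just above
    -- π u holds u and v but not w.
    anchor : ∀ {y π} → Levels π y → ¬ Sep y v u → π u ≡ π v →
             (π v′ ≡ π u → Sep y v′ u) → π w ≡ π v′ → Anchor y
    anchor {y} {π} lev ¬sep u≡v sep w≡v′ with ℕP.<-cmp (π v′) (π u)
    ... | tri< lt _ _ = inj₁ (below π (π u) , lev (π u) , ∈below⁺ π lt ,
          ℕP.<-irrefl refl ∘ ∈below⁻ π , ℕP.<-irrefl (sym u≡v) ∘ ∈below⁻ π)
    ... | tri≈ _ eq _ with sep eq
    ...   | S , tS , v′∈S , u∉S = inj₁ (S , tS , v′∈S , u∉S , λ v∈S → ¬sep (S , tS , v∈S , u∉S))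
    anchor {y} {π} lev ¬sep u≡v sep w≡v′ | tri> _ _ gt =
      inj₂ (below π (suc (π u)) , lev (suc (π u)) ,
            (λ w∈ → ℕP.<⇒≱ gt (subst (ℕ._≤ π u) w≡v′ (ℕ.s≤s⁻¹ (∈below⁻ π w∈)))) ,
            ∈below⁺ π (ℕP.n<1+n _) , ∈below⁺ π (ℕP.≤-reflexive (cong suc (sym u≡v))))

    anchor-exchange : ∀ {y} → Anchor y → Anchor (exchange y u v)
    anchor-exchange (inj₁ (S , tS , v′∈S , u∉S , v∉S)) =
      inj₁ (S , tight-exchange⁺ (trans (∉⇒lookup u∉S) (sym (∉⇒lookup v∉S))) tS , v′∈S , u∉S , v∉S)
    anchor-exchange (inj₂ (S , tS , w∉S , u∈S , v∈S)) =
      inj₂ (S , tight-exchange⁺ (trans ([]=⇒lookup u∈S) (sym ([]=⇒lookup v∈S))) tS , w∉S , u∈S , v∈S)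

    -- Exchanging at u and v neither creates nor destroys the exchange pair from w to v′, provided u
    -- itself has no exchange arc to v′. An anchor survives the exchange, so the same confinement
    -- serves both directions.
    sep-exchange : ∀ {y π} → InBase y → Levels π y → ¬ Sep y v u → π u ≡ π v →
      (π v′ ≡ π u → Sep y v′ u) → π w ≡ π v′ →
      (Sep y v′ w → Sep (exchange y u v) v′ w) × (Sep (exchange y u v) v′ w → Sep y v′ w)
    sep-exchange {y} b lev ¬sep u≡v sep w≡v′ =
      (λ s → let X , tX , v′∈X , w∉X , eq = confine b a s
             in X , tight-exchange⁺ eq tX , v′∈X , w∉X) ,
      (λ s → let X , tX , v′∈X , w∉X , eq = confine (exchange-base b ¬sep) (anchor-exchange a) s
             in X , tight-exchange⁻ eq tX , v′∈X , w∉X)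
      where
      a : Anchor y
      a = anchor lev ¬sep u≡v sep w≡v′

-- Breadth-first search

module _ {n} (d : Fin n → ℕ) (b : Fin n) where

  -- Labels rise by one along each arc, so a route never returns to a vertex. The first arc is
  -- outermost because augmentation consumes a route from its start.
  data Route (R : Fin n → Fin n → Set) : ℕ → Fin n → Set where
    done : Route R 0 b
    step : ∀ {k u v} → R u v → d v ≡ suc (d u) → Route R k v → Route R (suc k) u

  -- Labels along a route never fall below that of its start, so only arcs at label `i` or later
  -- have to survive a change of the relation.
  mapRoute : ∀ {R R′ : Fin n → Fin n → Set} {i} →
             (∀ {u v} → i ℕ.≤ d u → d v ≡ suc (d u) → R u v → R′ u v) →
             ∀ {k u} → i ℕ.≤ d u → Route R k u → Route R′ k u
  mapRoute f i≤d done           = done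
  mapRoute f i≤d (step r eq rs) = step (f i≤d eq r) eq
    (mapRoute f (ℕP.≤-trans i≤d (ℕP.≤-trans (ℕP.n≤1+n _) (ℕP.≤-reflexive (sym eq)))) rs)

module Search {n} (R : Fin n → Fin n → Set) (R? : ∀ u v → Dec (R u v)) (s : Fin n) where

  -- Invariant of the search: a label below k marks a vertex already reached, the label k marks one
  -- not reached so far.
  record Layered (k : ℕ) (d : Fin n → ℕ) : Set where
    field
      lipschitz : ∀ u v → R u v → d v ℕ.≤ suc (d u)
      capped    : ∀ v → d v ℕ.≤ k
      source    : d s ℕ.< k
      previous  : ∀ v → d v ℕ.< k → v ≡ s ⊎ ∃ λ u → R u v × d v ≡ suc (d u)

  initial : ∃ (Layered 1)
  initial = d , record
    { lipschitz = λ u v _ → ℕP.≤-trans (d≤1 v) (ℕ.s≤s ℕ.z≤n)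
    ; capped    = d≤1
    ; source    = source
    ; previous  = λ v lt → inj₁ (previous v lt)
    }
    where
    d : Fin n → ℕ
    d v with v ≟ s
    ... | yes _ = 0
    ... | no  _ = 1
    d≤1 : ∀ v → d v ℕ.≤ 1
    d≤1 v with v ≟ s
    ... | yes _ = ℕ.z≤n
    ... | no  _ = ℕP.≤-refl
    source : d s ℕ.< 1
    source with s ≟ s
    ... | yes _  = ℕP.≤-refl
    ... | no s≢s = contradiction refl s≢s
    previous : ∀ v → d v ℕ.< 1 → v ≡ s
    previous v lt with v ≟ s
    ... | yes eq = eq
    ... | no  _  = contradiction lt (ℕP.<-irrefl refl)

  module Extend {k d} (L : Layered k d) where
    open Layered L

    Frontier : Fin n → Set
    Frontier v = ∃ λ u → R u v × d u ℕ.< k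

    frontier? : ∀ v → Dec (Frontier v)
    frontier? v = any? λ u → R? u v ×-dec (d u ℕ.<? k)

    -- A vertex labelled k becomes reached by keeping its label if an arc enters it from a reached
    -- vertex; otherwise it moves to `suc k`, the new mark of the unreached.
    next : Fin n → ℕ
    next v with d v ℕ.<? k | frontier? v
    ... | yes _ | _     = d v
    ... | no  _ | yes _ = k
    ... | no  _ | no  _ = suc k

    data View (v : Fin n) : ℕ → Set where
      old : d v ℕ.< k → View v (d v)
      new : d v ≡ k → Frontier v → View v k
      far : d v ≡ k → ¬ Frontier v → View v (suc k)

    view : ∀ v → View v (next v)
    view v with d v ℕ.<? k | frontier? v
    ... | yes lt | _     = old lt
    ... | no  ≮k | yes r = new (ℕP.≤-antisym (capped v) (ℕP.≮⇒≥ ≮k)) r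
    ... | no  ≮k | no ¬r = far (ℕP.≤-antisym (capped v) (ℕP.≮⇒≥ ≮k)) ¬r

    next-old : ∀ v → d v ℕ.< k → next v ≡ d v
    next-old v lt with d v ℕ.<? k | frontier? v
    ... | yes _ | _ = refl
    ... | no ≮k | _ = contradiction lt ≮k

    d≤next : ∀ v → d v ℕ.≤ next v
    d≤next v with next v | view v
    ... | _ | old _   = ℕP.≤-refl
    ... | _ | new _ _ = capped v
    ... | _ | far _ _ = ℕP.m≤n⇒m≤1+n (capped v)

    next-layered : Layered (suc k) next
    next-layered = record
      { lipschitz = lip
      ; capped    = cap
      ; source    = subst (ℕ._< suc k) (sym (next-old s source)) (ℕP.m<n⇒m<1+n source)
      ; previous  = prev
      }
      where
      lip : ∀ u v → R u v → next v ℕ.≤ suc (next u)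
      lip u v r with next v | view v
      ... | _ | old _    = ℕP.≤-trans (lipschitz u v r) (ℕ.s≤s (d≤next u))
      ... | _ | new eq _ = ℕP.≤-trans (ℕP.≤-reflexive (sym eq)) (ℕP.≤-trans (lipschitz u v r) (ℕ.s≤s (d≤next u)))
      ... | _ | far _ ¬r = ℕ.s≤s (ℕP.≤-trans (ℕP.≮⇒≥ λ lt → ¬r (u , r , lt)) (d≤next u))
      cap : ∀ v → next v ℕ.≤ suc k
      cap v with next v | view v
      ... | _ | old lt  = ℕP.<⇒≤ (ℕP.m<n⇒m<1+n lt)
      ... | _ | new _ _ = ℕP.n≤1+n k
      ... | _ | far _ _ = ℕP.≤-refl
      prev : ∀ v → next v ℕ.< suc k → v ≡ s ⊎ ∃ λ u → R u v × next v ≡ suc (next u)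
      prev v lt with next v | view v
      ... | _ | far _ _ = contradiction lt (ℕP.<-irrefl refl)
      -- The predecessor has label exactly k - 1: less than k by choice, and no smaller by
      -- `lipschitz`.
      ... | _ | new eq (u , r , u<k) = inj₂ (u , r ,
              ℕP.≤-antisym (ℕP.≤-trans (ℕP.≤-reflexive (sym eq))
                             (ℕP.≤-trans (lipschitz u v r) (ℕ.s≤s (d≤next u))))
                           (subst (λ a → suc a ℕ.≤ k) (sym (next-old u u<k)) u<k))
      ... | _ | old v<k with previous v v<k
      ...   | inj₁ v≡s = inj₁ v≡s
      ...   | inj₂ (u , r , eq) = inj₂ (u , r , trans eq (cong suc (sym
              (next-old u (ℕP.<-trans (subst (d u ℕ.<_) (sym eq) (ℕP.n<1+n _)) v<k)))))

  Complete : ℕ → (Fin n → ℕ) → Set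
  Complete k d = Layered k d × (∀ u v → d u ℕ.< k → R u v → d v ℕ.< k)

  -- Each further round strictly enlarges the reached set, so the search ends by well-founded
  -- induction on `⊃`. It stops when no arc leaves that set.
  complete : ∀ {k d} → Layered k d → Acc _⊃_ (below d k) → ∃ λ k → ∃ (Complete k)
  complete {k} {d} L (acc rec) with any? (λ v → (d v ℕ.≟ k) ×-dec Extend.frontier? L v)
  ... | no none = k , d , L , λ u v u<k r →
          ℕP.≤∧≢⇒< (Layered.capped L v) λ eq → none (v , eq , u , r , u<k)
  ... | yes (v , eq , r) = complete next-layered (rec (
          (λ {u} u∈ → let u<k = ∈below⁻ d u∈ in
             ∈below⁺ next (subst (ℕ._< suc k) (sym (next-old u u<k)) (ℕP.m<n⇒m<1+n u<k))) ,
          v , ∈below⁺ next reached , λ v∈ → ℕP.<-irrefl eq (∈below⁻ d v∈)))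
    where
    open Extend L
    reached : next v ℕ.< suc k
    reached with next v | view v
    ... | _ | old v<k  = ℕP.m<n⇒m<1+n v<k
    ... | _ | new _ _  = ℕP.n<1+n k
    ... | _ | far _ ¬r = contradiction r ¬r

  module _ (b : Fin n) where

    -- Predecessors are followed back to the source and their arcs prepended; `j` is the label,
    -- which drops at every step.
    routeFrom : ∀ {k d} → Layered k d → ∀ j {i} v → d v ≡ j → d v ℕ.< k →
                Route d b R i v → ∃ λ i → Route d b R i s
    routeFrom L j v dv≡j dv<k rs with Layered.previous L v dv<k
    routeFrom L j       v dv≡j dv<k rs | inj₁ refl = _ , rs
    routeFrom L zero    v dv≡j dv<k rs | inj₂ (u , r , eq) = case trans (sym dv≡j) eq of λ ()
    routeFrom L (suc j) v dv≡j dv<k rs | inj₂ (u , r , eq) =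
      routeFrom L j u (ℕP.suc-injective (trans (sym eq) dv≡j))
        (ℕP.<-trans (ℕP.≤-reflexive (sym eq)) dv<k) (step r eq rs)

    -- The cut serves to raise the potential, the route to reroute a unit. The bound on labels
    -- across all arcs certifies that the route has no shortcut.
    search : (∃ λ S → s ∈ S × b ∉ S × (∀ u v → u ∈ S → R u v → v ∈ S))
           ⊎ (∃ λ d → (∀ u v → R u v → d v ℕ.≤ suc (d u)) × ∃ λ k → Route d b R k s)
    search with complete (proj₂ initial) (⊃-wellFounded _)
    ... | k , d , L , closed with d b ℕ.<? k
    ...   | yes b<k = inj₂ (d , Layered.lipschitz L , routeFrom L (d b) b refl b<k done)
    ...   | no  b≮k = inj₁ (below d k , ∈below⁺ d (Layered.source L) , b≮k ∘ ∈below⁻ d ,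
                            λ u v u∈ r → ∈below⁺ d (closed u v (∈below⁻ d u∈) r))

-- Edges in kilter and augmentation

ind : ∀ {n} → Fin n → Fin n → ℤ → ℤ
ind u v q = if does (u ≟ v) then q else 0ℤ

toℚ-ind : ∀ {n} (u v : Fin n) q → indicator u v (toℚ q) ≡ toℚ (ind u v q)
toℚ-ind u v q with u ≟ v
... | yes _ = refl
... | no  _ = refl

both : ∀ {A B : Set} → A → B → A ⇔ B
both a b = mk⇔ (λ _ → b) (λ _ → a)

neither : ∀ {A B : Set} → ¬ A → ¬ B → A ⇔ B
neither ¬a ¬b = mk⇔ (λ a → contradiction a ¬a) (λ b → contradiction b ¬b)


sub-decompose : ∀ {x y} → x ℤ.< y → ∃ λ k → y ≡ x ℤ.+ + suc k
sub-decompose {x} {y} x<y with y ℤ.- ℤ.suc x in eq | ℤP.i≤j⇒0≤j-i (ℤP.i<j⇒suc[i]≤j x<y)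
... | + k | _ = k , trans (r y x) (cong (λ d → x ℤ.+ (1ℤ ℤ.+ d)) eq)
  where
  r : ∀ y x → y ≡ x ℤ.+ (1ℤ ℤ.+ (y ℤ.- (1ℤ ℤ.+ x)))
  r = solve-∀

suc≤+suc : ∀ x k → ℤ.suc x ℤ.≤ x ℤ.+ + suc k
suc≤+suc x k = subst (ℤ._≤ x ℤ.+ + suc k) (ℤP.+-comm x 1ℤ) (ℤP.+-monoʳ-≤ x (ℤ.+≤+ (ℕ.s≤s ℕ.z≤n)))

+suc≰ : ∀ x k → ¬ x ℤ.+ + suc k ℤ.≤ x
+suc≰ x k le = ℤP.<⇒≱ (ℤP.suc[i]≤j⇒i<j (suc≤+suc x k)) le

dot : ∀ {n} → (Fin n → ℕ) → (Fin n → ℤ) → ℤ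
dot π y = sum (λ v → + π v ℤ.* y v)

dot-ind : ∀ {n} (π : Fin n → ℕ) u q → dot π (λ v → ind u v q) ≡ + π u ℤ.* q
dot-ind {n} π u q = begin
  dot π (λ v → ind u v q)                        ≡⟨ sum-update {g = λ _ → 0ℤ} u off ⟩
  sum {n} (λ _ → 0ℤ) ℤ.+ (on ℤ.- 0ℤ)             ≡⟨ cong₂ (λ a b → a ℤ.+ (b ℤ.- 0ℤ)) (sum-replicate-zero n) at ⟩
  0ℤ ℤ.+ (+ π u ℤ.* q ℤ.- 0ℤ)                    ≡⟨ trans (ℤP.+-identityˡ _) (ℤP.+-identityʳ _) ⟩
  + π u ℤ.* q                                    ∎
  where
  open ≡-Reasoning
  on = + π u ℤ.* ind u u q
  at : on ≡ + π u ℤ.* q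
  at = cong (λ b → + π u ℤ.* (if b then q else 0ℤ)) (dec-true (u ≟ u) refl)
  off : ∀ v → v ≢ u → + π v ℤ.* ind u v q ≡ 0ℤ
  off v v≢u = trans (cong (λ b → + π v ℤ.* (if b then q else 0ℤ)) (dec-false (u ≟ v) (v≢u ∘ sym)))
                    (ℤP.*-zeroʳ (+ π v))

dot-toℚ : ∀ {n} (π : Fin n → ℕ) {x : Fin n → ℚ} {y} → x ≗ toℚ ∘ y →
          (λ v → toℚ (+ π v)) · x ≡ toℚ (dot π y)
dot-toℚ π {x} {y} eq = trans
  (sumℚ-cong λ v → trans (cong (toℚ (+ π v) ℚ.*_) (eq v)) (sym (toℚ-* (+ π v) (y v))))
  (sumℚ-toℚ λ v → + π v ℤ.* y v)

module Flow {n m} (D : Digraph n m) (f : Fin m → ℤ₋) (g : Fin m → ℤ⁺)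
            (p : Subset n → ℤ₋) (supermodular : IsSupermodular p) where
  open Base p supermodular

  ψℤ : (Fin m → ℤ) → Fin n → ℤ
  ψℤ z v = sum (λ e → ind (head D e) v (z e)) ℤ.- sum (λ e → ind (tail D e) v (z e))

  ψ-toℚ : ∀ z v → ψ D (toℚ ∘ z) v ≡ toℚ (ψℤ z v)
  ψ-toℚ z v = trans (cong₂ ℚ._-_ (part (head D)) (part (tail D))) (sym (toℚ--
      (sum λ e → ind (head D e) v (z e)) (sum λ e → ind (tail D e) v (z e))))
    where
    part : ∀ (end : Fin m → Fin n) → sumℚ (λ e → indicator (end e) v (toℚ (z e))) ≡
           toℚ (sum (λ e → ind (end e) v (z e)))
    part end = trans (sumℚ-cong λ e → toℚ-ind (end e) v (z e)) (sumℚ-toℚ λ e → ind (end e) v (z e))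

  ψℤ-suc : ∀ {z z′} e → (∀ i → i ≢ e → z′ i ≡ z i) → z′ e ≡ ℤ.suc (z e) →
           ∀ v → ψℤ z′ v ≡ ψℤ z v ℤ.+ (δ (head D e) v ℤ.- δ (tail D e) v)
  ψℤ-suc {z} {z′} e off at v = begin
    ψℤ z′ v
      ≡⟨ cong₂ ℤ._-_ (part (head D)) (part (tail D)) ⟩
    (sum (λ i → ind (head D i) v (z i)) ℤ.+ δ (head D e) v) ℤ.-
    (sum (λ i → ind (tail D i) v (z i)) ℤ.+ δ (tail D e) v)
      ≡⟨ rearrange (sum λ i → ind (head D i) v (z i)) _ (sum λ i → ind (tail D i) v (z i)) _ ⟩
    ψℤ z v ℤ.+ (δ (head D e) v ℤ.- δ (tail D e) v) ∎
    where
    open ≡-Reasoning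
    rearrange : ∀ a b c d → (a ℤ.+ b) ℤ.- (c ℤ.+ d) ≡ (a ℤ.- c) ℤ.+ (b ℤ.- d)
    rearrange = solve-∀
    cell : ∀ b x → (if b then ℤ.suc x else 0ℤ) ℤ.- (if b then x else 0ℤ) ≡ (if b then 1ℤ else 0ℤ)
    cell true  x = trans (ℤP.+-assoc 1ℤ x (ℤ.- x)) (cong (ℤ._+_ 1ℤ) (ℤP.+-inverseʳ x))
    cell false x = refl
    part : ∀ (end : Fin m → Fin n) → sum (λ i → ind (end i) v (z′ i)) ≡
           sum (λ i → ind (end i) v (z i)) ℤ.+ δ (end e) v
    part end = trans (sum-update e λ i i≢e → cong (ind (end i) v) (off i i≢e))
      (cong (ℤ._+_ (sum λ i → ind (end i) v (z i)))
        (trans (cong (λ x → ind (end e) v x ℤ.- ind (end e) v (z e)) at)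
               (cell (does (end e ≟ v)) (z e))))

  sat : Bool → Fin m → ℤ → ℕ
  sat a e x = if a then (if saturated (g e) x then 1 else 0) else 0

  sat-cases : ∀ a e x → sat a e x ≡ 0 ⊎ (sat a e x ≡ 1 × g e ≡ fin⁺ x)
  sat-cases false e x = inj₁ refl
  sat-cases true  e x with g e
  ... | +∞ = inj₁ refl
  ... | fin⁺ b with b ℤ.≟ x
  ...   | yes refl = inj₂ (refl , refl)
  ...   | no  _    = inj₁ refl

  sat-below : ∀ a {e} x → fin⁺ (ℤ.suc x) ≤⁺ g e → sat a e x ≡ 0
  sat-below a {e} x le with sat-cases a e x
  ... | inj₁ eq       = eq
  ... | inj₂ (_ , eq) with subst (fin⁺ (ℤ.suc x) ≤⁺_) eq le
  ...   | fin≤ q = contradiction (ℤP.suc[i]≤j⇒i<j q) (ℤP.<-irrefl refl)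

  -- Optimality of x for cost [x = g e] (charged only if a holds) minus (i - j) x,
  -- where i and j are the potentials of the tail and the head of e.
  record Kilter (a : Bool) (i j : ℕ) (e : Fin m) (x : ℤ) : Set where
    field
      lo   : f e ≤₋ fin₋ x
      hi   : fin⁺ x ≤⁺ g e
      up   : fin⁺ (ℤ.suc x) ≤⁺ g e → i ℕ.≤ sat a e (ℤ.suc x) ℕ.+ j
      down : f e ≤₋ fin₋ (ℤ.pred x) → sat a e x ℕ.+ j ℕ.≤ i

  module _ {a i j e x} (K : Kilter a i j e x) where
    open Kilter K

    -- `up` and `slope` together make the step to `suc x` neutral. If one more step fits under g,
    -- then `suc x` is unsaturated and the old `up` reads i ≤ j, which gives the new one.
    kilter-suc : fin⁺ (ℤ.suc x) ≤⁺ g e → sat a e (ℤ.suc x) ℕ.+ j ℕ.≤ i → Kilter a i j e (ℤ.suc x)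
    kilter-suc le slope = record
      { lo   = ≤₋-trans lo (fin≤ (ℤP.i≤suc[i] x))
      ; hi   = le
      ; up   = λ le′ → ℕP.≤-trans (subst (λ c → i ℕ.≤ c ℕ.+ j) (sat-below a (ℤ.suc x) le′) (up le))
                                  (ℕP.m≤n+m j _)
      ; down = λ _ → slope
      }

    kilter-pred : f e ≤₋ fin₋ (ℤ.pred x) → i ℕ.≤ sat a e x ℕ.+ j → Kilter a i j e (ℤ.pred x)
    kilter-pred le slope = record
      { lo   = le
      ; hi   = ≤⁺-trans (fin≤ (ℤP.i≤j⇒pred[i]≤j ℤP.≤-refl)) hi
      ; up   = λ _ → subst (λ y → i ℕ.≤ sat a e y ℕ.+ j) (sym (ℤP.suc-pred x)) slope
      ; down = λ _ → subst (λ c → c ℕ.+ j ℕ.≤ i) (sym below-g) (ℕP.≤-trans (ℕP.m≤n+m j _) (down le))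
      }
      where
      below-g : sat a e (ℤ.pred x) ≡ 0
      below-g = sat-below a (ℤ.pred x) (subst (λ y → fin⁺ y ≤⁺ g e) (sym (ℤP.suc-pred x)) hi)

    -- Without a residual arc from tail to head, `up` is strict and has room for one more unit of
    -- potential at the tail. The head is treated symmetrically through `down`.
    kilter-raise-tail : (fin⁺ (ℤ.suc x) ≤⁺ g e → ¬ sat a e (ℤ.suc x) ℕ.+ j ℕ.≤ i) → Kilter a (suc i) j e x
    kilter-raise-tail none = record
      { lo = lo ; hi = hi
      ; up   = λ le → ℕP.≰⇒> (none le)
      ; down = λ le → ℕP.m≤n⇒m≤1+n (down le)
      }

    kilter-raise-head : (f e ≤₋ fin₋ (ℤ.pred x) → ¬ i ℕ.≤ sat a e x ℕ.+ j) → Kilter a i (suc j) e x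
    kilter-raise-head none = record
      { lo = lo ; hi = hi
      ; up   = λ le → ℕP.≤-trans (up le) (ℕP.+-monoʳ-≤ (sat a e (ℤ.suc x)) (ℕP.n≤1+n j))
      ; down = λ le → subst (ℕ._≤ i) (sym (ℕP.+-suc (sat a e x) j)) (ℕP.≰⇒> (none le))
      }

    kilter-raise-both : Kilter a (suc i) (suc j) e x
    kilter-raise-both = record
      { lo = lo ; hi = hi
      ; up   = λ le → subst (suc i ℕ.≤_) (sym (ℕP.+-suc (sat a e (ℤ.suc x)) j)) (ℕ.s≤s (up le))
      ; down = λ le → subst (ℕ._≤ suc i) (sym (ℕP.+-suc (sat a e x) j)) (ℕ.s≤s (down le))
      }

  AllKilter : (Fin m → Bool) → (Fin n → ℕ) → (Fin m → ℤ) → Set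
  AllKilter ℓ π z = ∀ e → Kilter (ℓ e) (π (tail D e)) (π (head D e)) e (z e)

  record Optimal (ℓ : Fin m → Bool) (π : Fin n → ℕ) (z : Fin m → ℤ) : Set where
    field
      kilter : AllKilter ℓ π z
      base   : InBase (ψℤ z)
      levels : Levels π (ψℤ z)

  -- Residual arcs and augmentation along a shortest route

  module Residual (ℓ : Fin m → Bool) (π : Fin n → ℕ) where

    -- Under `Kilter` the reverse inequality holds too, so the increase has reduced cost zero;
    -- likewise for `Decreasable`.
    Increasable : Fin m → ℤ → Set
    Increasable e x = fin⁺ (ℤ.suc x) ≤⁺ g e × sat (ℓ e) e (ℤ.suc x) ℕ.+ π (head D e) ℕ.≤ π (tail D e)

    Decreasable : Fin m → ℤ → Set
    Decreasable e x = f e ≤₋ fin₋ (ℤ.pred x) × π (tail D e) ℕ.≤ sat (ℓ e) e x ℕ.+ π (head D e)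

    -- `fwd` and `bwd` change the flow, `exch` changes the base vector y. Equal potentials at the
    -- ends of an `exch` arc keep every level set tight.
    data Arc (z : Fin m → ℤ) (y : Fin n → ℤ) (u v : Fin n) : Set where
      exch : π u ≡ π v → ¬ Sep y v u → Arc z y u v
      fwd  : ∀ e → tail D e ≡ u → head D e ≡ v → Increasable e (z e) → Arc z y u v
      bwd  : ∀ e → head D e ≡ u → tail D e ≡ v → Decreasable e (z e) → Arc z y u v

    arc? : ∀ z y u v → Dec (Arc z y u v)
    arc? z y u v = map′
      (λ { (inj₁ (eq , ¬s)) → exch eq ¬s
         ; (inj₂ (inj₁ (e , t , h , r))) → fwd e t h r
         ; (inj₂ (inj₂ (e , h , t , r))) → bwd e h t r })
      (λ { (exch eq ¬s)  → inj₁ (eq , ¬s)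
         ; (fwd e t h r) → inj₂ (inj₁ (e , t , h , r))
         ; (bwd e h t r) → inj₂ (inj₂ (e , h , t , r)) })
      (((π u ℕ.≟ π v) ×-dec ¬? (sep? y v u)) ⊎-dec
       any? (λ e → (tail D e ≟ u) ×-dec (head D e ≟ v) ×-dec
                   (_ ≤⁺? _) ×-dec (_ ℕ.≤? _)) ⊎-dec
       any? (λ e → (head D e ≟ u) ×-dec (tail D e ≟ v) ×-dec
                   (_ ≤₋? _) ×-dec (_ ℕ.≤? _)))

    arc-update : ∀ {z z′ y s u v} e → tail D e ≡ s ⊎ head D e ≡ s → (∀ i → i ≢ e → z′ i ≡ z i) →
                 u ≢ s → v ≢ s → Arc z y u v → Arc z′ y u v
    arc-update e end off u≢s v≢s (exch eq ¬s) = exch eq ¬s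
    arc-update e end off u≢s v≢s (fwd i refl refl r) =
      fwd i refl refl (subst (Increasable i) (sym (off i λ { refl → [ u≢s , v≢s ]′ end })) r)
    arc-update e end off u≢s v≢s (bwd i refl refl r) =
      bwd i refl refl (subst (Decreasable i) (sym (off i λ { refl → [ v≢s , u≢s ]′ end })) r)

    kilter-updateAt : ∀ {z} e h → AllKilter ℓ π z →
      Kilter (ℓ e) (π (tail D e)) (π (head D e)) e (h (z e)) → AllKilter ℓ π (updateAt z e h)
    kilter-updateAt {z} e h K Ke i with i ≟ e
    ... | yes refl = subst (Kilter _ _ _ i) (sym (updateAt-updates i z)) Ke
    ... | no  i≢e  = subst (Kilter _ _ _ i) (sym (updateAt-minimal i e z i≢e)) (K i)

    module _ (d : Fin n → ℕ) (b : Fin n) where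

      -- The part of shortest-path minimality that uncrossing calls on. It is asked only from label
      -- `i` onwards, that is, of what lies ahead of the current vertex.
      NoShortcut : ℕ → (Fin n → ℤ) → Set
      NoShortcut i y = ∀ u v → i ℕ.≤ d u → suc (d u) ℕ.< d v → π u ≡ π v → Sep y v u

      later : ∀ {s v u} → d v ≡ suc (d s) → d v ℕ.≤ d u → u ≢ s
      later eq le refl = ℕP.<⇒≱ (ℕP.≤-reflexive (sym eq)) le

      -- A unit of excess travels from s to b along the route; y is the net inflow that results
      -- if it jumps from s straight to b.
      augment : ∀ k {z y s} → AllKilter ℓ π z → InBase y → Levels π y →
        (∀ w → ψℤ z w ≡ y w ℤ.+ (δ s w ℤ.- δ b w)) → NoShortcut (d s) y →
        Route d b (Arc z y) k s → ∃ (Optimal ℓ π)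
      augment zero {z} {y} K B lev bal ns done = z , record
        { kilter = K ; base = InBase-resp-≗ y≗ψ B ; levels = Levels-resp-≗ y≗ψ lev }
        where
        y≗ψ : y ≗ ψℤ z
        y≗ψ w = sym (trans (bal w) (trans (cong (ℤ._+_ (y w)) (ℤP.+-inverseʳ (δ b w))) (ℤP.+-identityʳ (y w))))
      augment (suc k) {z} {y} {s} K B lev bal ns (step {v = v} arc dv rs) with arc
      -- The flow stays; y takes up the unit at s and releases it at v.
      ... | exch πs≡πv ¬sep = augment k K (exchange-base B ¬sep) (levels-exchange πs≡πv lev) bal′ ns′
              (mapRoute d b keep ℕP.≤-refl rs)
        where
        bal′ : ∀ w → ψℤ z w ≡ exchange y s v w ℤ.+ (δ v w ℤ.- δ b w)
        bal′ w = trans (bal w) (rearrange (y w) (δ s w) (δ v w) (δ b w))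
          where
          rearrange : ∀ a b c d → a ℤ.+ (b ℤ.- d) ≡ (a ℤ.+ (b ℤ.- c)) ℤ.+ (c ℤ.- d)
          rearrange = solve-∀
        -- Here w lies at least two labels beyond s, so `ns` rules out an exchange arc from s to w,
        -- as `sep-exchange` demands.
        transfer : ∀ {u w} → d v ℕ.≤ d u → d u ℕ.< d w → π u ≡ π w →
                   (Sep y w u → Sep (exchange y s v) w u) × (Sep (exchange y s v) w u → Sep y w u)
        transfer {u} {w} v≤u u<w πu≡πw = sep-exchange B lev ¬sep πs≡πv
          (λ eq → ns s w ℕP.≤-refl (ℕP.≤-<-trans (ℕP.≤-trans (ℕP.≤-reflexive (sym dv)) v≤u) u<w) (sym eq)) πu≡πw
        ns′ : NoShortcut (d v) (exchange y s v)
        ns′ u w v≤u lt eq = proj₁ (transfer v≤u (ℕP.<-trans (ℕP.n<1+n _) lt) eq)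
          (ns u w (ℕP.≤-trans (ℕP.≤-trans (ℕP.n≤1+n _) (ℕP.≤-reflexive (sym dv))) v≤u) lt eq)
        keep : ∀ {u w} → d v ℕ.≤ d u → d w ≡ suc (d u) → Arc z y u w → Arc z (exchange y s v) u w
        keep v≤u dw (exch eq ¬s)  = exch eq (¬s ∘ proj₂ (transfer v≤u (ℕP.≤-reflexive (sym dw)) eq))
        keep v≤u dw (fwd e t h r) = fwd e t h r
        keep v≤u dw (bwd e h t r) = bwd e h t r
      ... | fwd e refl refl r = augment k {updateAt z e ℤ.suc}
              (kilter-updateAt e ℤ.suc K (kilter-suc (K e) (proj₁ r) (proj₂ r))) B lev bal′
              (λ u w → ns u w ∘ ℕP.≤-trans d≤)
              (mapRoute d b keep ℕP.≤-refl rs)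
        where
        d≤ : d (tail D e) ℕ.≤ d (head D e)
        d≤ = ℕP.≤-trans (ℕP.n≤1+n _) (ℕP.≤-reflexive (sym dv))
        off : ∀ i → i ≢ e → updateAt z e ℤ.suc i ≡ z i
        off i = updateAt-minimal i e z
        bal′ : ∀ w → ψℤ (updateAt z e ℤ.suc) w ≡ y w ℤ.+ (δ (head D e) w ℤ.- δ b w)
        bal′ w = trans (ψℤ-suc e off (updateAt-updates e z) w)
          (trans (cong (ℤ._+ (δ (head D e) w ℤ.- δ (tail D e) w)) (bal w))
                 (rearrange (y w) (δ (tail D e) w) (δ (head D e) w) (δ b w)))
          where
          rearrange : ∀ a b c d → (a ℤ.+ (b ℤ.- d)) ℤ.+ (c ℤ.- b) ≡ a ℤ.+ (c ℤ.- d)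
          rearrange = solve-∀
        -- Later arcs avoid the tail of e, whose label is smaller than theirs, so none of them runs
        -- along e.
        keep : ∀ {u w} → d (head D e) ℕ.≤ d u → d w ≡ suc (d u) → Arc z y u w → Arc (updateAt z e ℤ.suc) y u w
        keep v≤u dw = arc-update e (inj₁ refl) off
          (later dv v≤u)
          (later dv (ℕP.≤-trans v≤u (ℕP.≤-trans (ℕP.n≤1+n _) (ℕP.≤-reflexive (sym dw)))))
      ... | bwd e refl refl r = augment k {updateAt z e ℤ.pred}
              (kilter-updateAt e ℤ.pred K (kilter-pred (K e) (proj₁ r) (proj₂ r))) B lev bal′
              (λ u w → ns u w ∘ ℕP.≤-trans d≤)
              (mapRoute d b keep ℕP.≤-refl rs)
        where
        d≤ : d (head D e) ℕ.≤ d (tail D e)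
        d≤ = ℕP.≤-trans (ℕP.n≤1+n _) (ℕP.≤-reflexive (sym dv))
        off : ∀ i → i ≢ e → updateAt z e ℤ.pred i ≡ z i
        off i = updateAt-minimal i e z
        bal′ : ∀ w → ψℤ (updateAt z e ℤ.pred) w ≡ y w ℤ.+ (δ (tail D e) w ℤ.- δ b w)
        -- `ψℤ-suc` is applied from the lowered flow back up to z.
        bal′ w = rearrange (y w) (δ (head D e) w) (δ (tail D e) w) (δ b w) _
          (trans (sym (ψℤ-suc {updateAt z e ℤ.pred} {z} e (λ i i≢e → sym (off i i≢e))
             (sym (trans (cong ℤ.suc (updateAt-updates e z)) (ℤP.suc-pred (z e)))) w)) (bal w))
          where
          rearrange : ∀ a b c d x → x ℤ.+ (b ℤ.- c) ≡ a ℤ.+ (b ℤ.- d) → x ≡ a ℤ.+ (c ℤ.- d)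
          rearrange a b c d x eq = trans (l x b c) (trans (cong (ℤ._+ (c ℤ.- b)) eq) (r′ a b c d))
            where
            l : ∀ x b c → x ≡ (x ℤ.+ (b ℤ.- c)) ℤ.+ (c ℤ.- b)
            l = solve-∀
            r′ : ∀ a b c d → (a ℤ.+ (b ℤ.- d)) ℤ.+ (c ℤ.- b) ≡ a ℤ.+ (c ℤ.- d)
            r′ = solve-∀
        keep : ∀ {u w} → d (tail D e) ℕ.≤ d u → d w ≡ suc (d u) → Arc z y u w → Arc (updateAt z e ℤ.pred) y u w
        keep v≤u dw = arc-update e (inj₂ refl) off
          (later dv v≤u)
          (later dv (ℕP.≤-trans v≤u (ℕP.≤-trans (ℕP.n≤1+n _) (ℕP.≤-reflexive (sym dw)))))

  -- Changing the charge at e₀ affects `Kilter` there only. A charge relaxes `up`, so only `down`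
  -- can fail, and it is vacuous when f forbids lowering z e₀.
  extend : ∀ {ℓ ℓ′} e₀ → ℓ e₀ ≡ false → (∀ e → e ≢ e₀ → ℓ e ≡ ℓ′ e) →
           ∃ (λ π → ∃ (Optimal ℓ π)) → ∃ λ π → ∃ (Optimal ℓ′ π)
  extend {ℓ} {ℓ′} e₀ ℓe₀ same (π , z , opt) = byDown (f e₀ ≤₋? fin₋ (ℤ.pred x)) (sat a e₀ x ℕ.+ j ℕ.≤? i)
    where
    open Optimal opt
    open Residual ℓ′ π
    a = ℓ′ e₀
    x = z e₀
    i = π (tail D e₀)
    j = π (head D e₀)
    K₀ : Kilter false i j e₀ x
    K₀ = subst (λ b → Kilter b i j e₀ x) ℓe₀ (kilter e₀)
    Kₑ : ∀ e → e ≢ e₀ → Kilter (ℓ′ e) (π (tail D e)) (π (head D e)) e (z e)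
    Kₑ e e≢e₀ = subst (λ b → Kilter b _ _ e (z e)) (same e e≢e₀) (kilter e)

    unchanged : (f e₀ ≤₋ fin₋ (ℤ.pred x) → sat a e₀ x ℕ.+ j ℕ.≤ i) → ∃ λ π → ∃ (Optimal ℓ′ π)
    unchanged slope = π , z , record { kilter = K ; base = base ; levels = levels }
      where
      K : AllKilter ℓ′ π z
      K e with e ≟ e₀
      ... | no  e≢e₀ = Kₑ e e≢e₀
      ... | yes refl = record
        { lo = Kilter.lo K₀ ; hi = Kilter.hi K₀
        ; up = λ le → ℕP.≤-trans (Kilter.up K₀ le) (ℕP.m≤n+m j _)
        ; down = slope }

    -- Here z e₀ = g e₀ and i = j.
    reroute : f e₀ ≤₋ fin₋ (ℤ.pred x) → ¬ sat a e₀ x ℕ.+ j ℕ.≤ i → ∃ λ π → ∃ (Optimal ℓ′ π)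
    reroute le bad with Search.search (Arc z⁻ y) (arc? z⁻ y)
      (tail D e₀) (head D e₀)
      where
      z⁻ = updateAt z e₀ ℤ.pred
      y = ψℤ z
    ... | inj₁ (S , s∈S , b∉S , closed) = raise π S , z , record
      { kilter = K ; base = base ; levels = levels-raise base levels sepᶜ }
      where
      j≤i : j ℕ.≤ i
      j≤i = Kilter.down K₀ le
      saturated-here : sat a e₀ x ≡ 1 × g e₀ ≡ fin⁺ x
      saturated-here with sat-cases a e₀ x
      ... | inj₂ r  = r
      ... | inj₁ eq = contradiction (subst (λ c → c ℕ.+ j ℕ.≤ i) (sym eq) j≤i) bad
      sepᶜ : ∀ u v → u ∈ S → v ∉ S → π u ≡ π v → Sep (ψℤ z) v u
      sepᶜ u v u∈S v∉S eq = decidable-stable (sep? (ψℤ z) v u) λ ¬s → v∉S (closed u v u∈S (exch eq ¬s))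
      K : AllKilter ℓ′ (raise π S) z
      K e with e ≟ e₀
      -- The tail is in S and the head is not, so the tail gains the unit of potential that pays for
      -- the charge; `up` is void at saturation.
      ... | yes refl rewrite []=⇒lookup s∈S | ∉⇒lookup b∉S = record
        { lo = Kilter.lo K₀ ; hi = Kilter.hi K₀
        ; up = λ le′ → case subst (fin⁺ (ℤ.suc x) ≤⁺_) (proj₂ saturated-here) le′ of λ where
            (fin≤ q) → contradiction (ℤP.suc[i]≤j⇒i<j q) (ℤP.<-irrefl refl)
        ; down = λ _ → subst (λ c → c ℕ.+ j ℕ.≤ suc i) (sym (proj₁ saturated-here)) (ℕ.s≤s j≤i)
        }
      ... | no e≢e₀ with lookup S (tail D e) in eqt | lookup S (head D e) in eqh
      ...   | true  | true  = kilter-raise-both (Kₑ e e≢e₀)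
      ...   | false | false = Kₑ e e≢e₀
      ...   | true  | false = kilter-raise-tail (Kₑ e e≢e₀) λ q r → lookup⇒∉ eqh
              (closed _ _ (lookup⇒[]= _ S eqt) (fwd e refl refl
                (subst (Increasable e) (sym (updateAt-minimal e e₀ z e≢e₀)) (q , r))))
      ...   | false | true  = kilter-raise-head (Kₑ e e≢e₀) λ q r → lookup⇒∉ eqt
              (closed _ _ (lookup⇒[]= _ S eqh) (bwd e refl refl
                (subst (Decreasable e) (sym (updateAt-minimal e e₀ z e≢e₀)) (q , r))))
    ... | inj₂ (d , lipschitz , k , route) = π , augment d (head D e₀) k K base levels bal shortcut route
      where
      z⁻ = updateAt z e₀ ℤ.pred
      y = ψℤ z
      -- The charge is 1 and `down` fails with it, so i < 1 + j. The old `down` supplies j ≤ i,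
      -- making the ends equal in potential.
      i≤j : i ℕ.≤ j
      i≤j with sat-cases a e₀ x
      ... | inj₁ eq = contradiction (subst (λ c → c ℕ.+ j ℕ.≤ i) (sym eq) (Kilter.down K₀ le)) bad
      ... | inj₂ (eq , _) = ℕ.s≤s⁻¹ (ℕP.≰⇒> (subst (λ c → ¬ c ℕ.+ j ℕ.≤ i) eq bad))
      K : AllKilter ℓ′ π z⁻
      K e with e ≟ e₀
      ... | no e≢e₀  = subst (Kilter _ _ _ e) (sym (updateAt-minimal e e₀ z e≢e₀)) (Kₑ e e≢e₀)
      ... | yes refl = subst (Kilter _ _ _ e) (sym (updateAt-updates e z)) (record
        { lo = le
        ; hi = ≤⁺-trans (fin≤ (ℤP.i≤j⇒pred[i]≤j ℤP.≤-refl)) (Kilter.hi K₀)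
        ; up = λ _ → ℕP.≤-trans i≤j (ℕP.m≤n+m j _)
        ; down = λ _ → subst (λ c → c ℕ.+ j ℕ.≤ i) (sym (sat-below a (ℤ.pred x)
            (subst (λ y → fin⁺ y ≤⁺ g e) (sym (ℤP.suc-pred x)) (Kilter.hi K₀)))) (Kilter.down K₀ le)
        })
      bal : ∀ w → ψℤ z⁻ w ≡ y w ℤ.+ (δ (tail D e₀) w ℤ.- δ (head D e₀) w)
      bal w = rearrange (ψℤ z⁻ w) (y w) (δ (head D e₀) w) (δ (tail D e₀) w) (ψℤ-suc {z⁻} {z} e₀ (λ e e≢e₀ → sym (updateAt-minimal e e₀ z e≢e₀))
        (sym (trans (cong ℤ.suc (updateAt-updates e₀ z)) (ℤP.suc-pred x))) w)
        where
        rearrange : ∀ a b c d → b ≡ a ℤ.+ (c ℤ.- d) → a ≡ b ℤ.+ (d ℤ.- c)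
        rearrange a b c d refl = l a c d
          where
          l : ∀ a c d → a ≡ (a ℤ.+ (c ℤ.- d)) ℤ.+ (d ℤ.- c)
          l = solve-∀
      shortcut : NoShortcut d (head D e₀) (d (tail D e₀)) y
      shortcut u v _ lt eq = decidable-stable (sep? y v u) λ ¬s →
        ℕP.<⇒≱ lt (lipschitz u v (exch eq ¬s))

    byDown : Dec (f e₀ ≤₋ fin₋ (ℤ.pred x)) → Dec (sat a e₀ x ℕ.+ j ℕ.≤ i) → ∃ λ π → ∃ (Optimal ℓ′ π)
    byDown _        (yes slope) = unchanged λ _ → slope
    byDown (no  ≰)  _           = unchanged λ le → contradiction le ≰
    byDown (yes le) (no bad)    = reroute le bad

  -- With no charges and zero potential every feasible integral flow is optimal: a level set is
  -- empty or everything, so there is no pair to separate.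
  start : ∀ z → (∀ e → f e ≤₋ fin₋ (z e)) → (∀ e → fin⁺ (z e) ≤⁺ g e) → InBase (ψℤ z) →
          Optimal (λ _ → false) (λ _ → 0) z
  start z lo hi base = record
    { kilter = λ e → record { lo = lo e ; hi = hi e ; up = λ _ → ℕ.z≤n ; down = λ _ → ℕ.z≤n }
    ; base   = base
    ; levels = λ t → separated⇒tight base _ λ v u v∈ u∉ →
        contradiction (∈below⁺ (λ _ → 0) (∈below⁻ (λ _ → 0) {t} {v} v∈)) u∉
    }

  solve : ∀ ℓ → ∃ (Optimal (λ _ → false) (λ _ → 0)) → ∃ λ π → ∃ (Optimal ℓ π)
  solve ℓ opt₀ = let ℓ′ , (π , z , opt) , _ , all = sweep m (λ e → e) in
    π , z , record
      { kilter = λ e → subst (λ b → Kilter b (π (tail D e)) (π (head D e)) e (z e)) (all e) (Optimal.kilter opt e)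
      ; base   = Optimal.base opt
      ; levels = Optimal.levels opt }
    where
    -- The invariant that an edge is uncharged or already has its final charge permits repetitions
    -- in `es`.
    sweep : ∀ k (es : Fin k → Fin m) → ∃ λ ℓ′ → ∃ (λ π → ∃ (Optimal ℓ′ π)) ×
            (∀ e → ℓ′ e ≡ false ⊎ ℓ′ e ≡ ℓ e) × (∀ i → ℓ′ (es i) ≡ ℓ (es i))
    sweep zero    es = (λ _ → false) , (_ , opt₀) , (λ _ → inj₁ refl) , λ ()
    sweep (suc k) es with sweep k (es ∘ suc)
    ... | ℓ′ , opt , partial , all with partial (es zero)
    ...   | inj₂ eq = ℓ′ , opt , partial , λ { zero → eq ; (suc i) → all i }
    ...   | inj₁ eq = ℓ″ , extend e₀ eq (λ e e≢e₀ → sym (updateAt-minimal e e₀ ℓ′ e≢e₀)) opt ,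
                      partial′ , all′
      where
      e₀ = es zero
      ℓ″ = updateAt ℓ′ e₀ (λ _ → ℓ e₀)
      at-e₀ : ℓ″ e₀ ≡ ℓ e₀
      at-e₀ = updateAt-updates e₀ ℓ′
      partial′ : ∀ e → ℓ″ e ≡ false ⊎ ℓ″ e ≡ ℓ e
      partial′ e with e ≟ e₀
      ... | yes refl = inj₂ at-e₀
      ... | no e≢e₀ rewrite updateAt-minimal e e₀ {λ _ → ℓ e₀} ℓ′ e≢e₀ = partial e
      all′ : ∀ i → ℓ″ (es i) ≡ ℓ (es i)
      all′ zero    = at-e₀
      all′ (suc i) with es (suc i) ≟ e₀
      ... | yes eq′ = subst (λ e → ℓ″ e ≡ ℓ e) (sym eq′) at-e₀
      ... | no ne   = trans (updateAt-minimal (es (suc i)) e₀ ℓ′ ne) (all i)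

  -- Complementary slackness

  -- Reduced cost. Summed over all edges, its linear terms give `dot π (ψℤ z)` by `dot-ψ`.
  cost : Bool → ℕ → ℕ → Fin m → ℤ → ℤ
  cost a i j e x = + sat a e x ℤ.+ (+ j ℤ.- + i) ℤ.* x

  module _ (a : Bool) (i j : ℕ) (e : Fin m) (x : ℤ) where

    -- The excess over the cost at x is a natural number r: minimality of x is built in, and r = 0
    -- picks out the optimal values.
    record RightEnd : Set where
      field
        hi     : ℤ⁺
        x≤hi   : fin⁺ x ≤⁺ hi
        hi≤g   : hi ≤⁺ g e
        excess : ∀ k → fin⁺ (x ℤ.+ + suc k) ≤⁺ g e → ∃ λ r →
                 cost a i j e (x ℤ.+ + suc k) ≡ cost a i j e x ℤ.+ + r ×
                 (r ≡ 0 ⇔ fin⁺ (x ℤ.+ + suc k) ≤⁺ hi)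

    record LeftEnd : Set where
      field
        lo     : ℤ₋
        f≤lo   : f e ≤₋ lo
        lo≤x   : lo ≤₋ fin₋ x
        excess : ∀ k {w} → x ≡ w ℤ.+ + suc k → f e ≤₋ fin₋ w → ∃ λ r →
                 cost a i j e w ≡ cost a i j e x ℤ.+ + r ×
                 (r ≡ 0 ⇔ lo ≤₋ fin₋ w)

  -- Where the slope is zero the optimal values extend to g, or to g - 1 when the edge is charged
  -- and g is finite.
  unsaturated : ∀ a e {x} → fin⁺ x ≤⁺ g e → sat a e x ≡ 0 → ∃ λ hi →
    fin⁺ x ≤⁺ hi × hi ≤⁺ g e × (∀ w → fin⁺ w ≤⁺ g e → sat a e w ≡ 0 ⇔ fin⁺ w ≤⁺ hi)
  unsaturated false e x≤g _ = g e , x≤g , ≤⁺-refl , λ w w≤g → both refl w≤g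
  unsaturated true  e x≤g s with g e
  ... | +∞     = +∞ , ≤+∞ , ≤+∞ , λ w w≤g → both refl w≤g
  ... | fin⁺ b = fin⁺ (ℤ.pred b) , to (iff _ x≤g) s , fin≤ (ℤP.i≤j⇒pred[i]≤j ℤP.≤-refl) , iff
    where
    iff : ∀ w → fin⁺ w ≤⁺ fin⁺ b → (if saturated (fin⁺ b) w then 1 else 0) ≡ 0 ⇔ fin⁺ w ≤⁺ fin⁺ (ℤ.pred b)
    iff w (fin≤ w≤b) with b ℤ.≟ w
    ... | yes refl = neither (λ ()) (λ { (fin≤ q) → ℤP.<-irrefl refl (ℤP.i≤pred[j]⇒i<j q) })
    ... | no  b≢w  = both refl (fin≤ (ℤP.i<j⇒i≤pred[j] (ℤP.≤∧≢⇒< w≤b (b≢w ∘ sym))))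

  cost-right : ∀ a i d e x k → sat a e x ≡ 0 →
    cost a i (i ℕ.+ d) e (x ℤ.+ + k) ≡
    cost a i (i ℕ.+ d) e x ℤ.+ + (sat a e (x ℤ.+ + k) ℕ.+ d ℕ.* k)
  cost-right a i d e x k s rewrite s =
    trans (ring (+ i) (+ d) x (+ k) (+ sat a e (x ℤ.+ + k)))
          (cong (λ t → (0ℤ ℤ.+ ((+ i ℤ.+ + d) ℤ.- + i) ℤ.* x) ℤ.+ (+ sat a e (x ℤ.+ + k) ℤ.+ t))
                (sym (ℤP.pos-* d k)))
    where
    ring : ∀ I D x K S → S ℤ.+ ((I ℤ.+ D) ℤ.- I) ℤ.* (x ℤ.+ K) ≡
           (0ℤ ℤ.+ ((I ℤ.+ D) ℤ.- I) ℤ.* x) ℤ.+ (S ℤ.+ D ℤ.* K)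
    ring = solve-∀

  cost-left : ∀ a j d e x k → sat a e x ≡ 0 →
    cost a (j ℕ.+ d) j e x ℤ.+ + sat a e (x ℤ.+ + k) ≡
    cost a (j ℕ.+ d) j e (x ℤ.+ + k) ℤ.+ + (d ℕ.* k)
  cost-left a j d e x k s rewrite s =
    trans (ring (+ j) (+ d) x (+ k) (+ sat a e (x ℤ.+ + k)))
          (cong (ℤ._+_ (cost a (j ℕ.+ d) j e (x ℤ.+ + k))) (sym (ℤP.pos-* d k)))
    where
    ring : ∀ J D x K S → (0ℤ ℤ.+ (J ℤ.- (J ℤ.+ D)) ℤ.* x) ℤ.+ S ≡
           (S ℤ.+ (J ℤ.- (J ℤ.+ D)) ℤ.* (x ℤ.+ K)) ℤ.+ D ℤ.* K
    ring = solve-∀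

  m+n≢0 : ∀ m {n} → n ≢ 0 → m ℕ.+ n ≢ 0
  m+n≢0 m n≢0 = n≢0 ∘ ℕP.m+n≡0⇒n≡0 m

  -- With room above x, split by the charge at `suc x`. If there is none, i ≤ j and the cost is flat
  -- until saturation or rises at once. If there is one, `suc x` is g e, the only value to the
  -- right, and it is optimal exactly when i = j + 1: the linear gain then pays for the charge.
  rightEnd : ∀ {a i j e x} → Kilter a i j e x → RightEnd a i j e x
  rightEnd {a} {i} {j} {e} {x} K = byCap (fin⁺ (ℤ.suc x) ≤⁺? g e)
    where
    open Kilter K
    stay : (∀ k → fin⁺ (x ℤ.+ + suc k) ≤⁺ g e → ∃ λ r →
             cost a i j e (x ℤ.+ + suc k) ≡ cost a i j e x ℤ.+ + r × r ≢ 0) →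
           RightEnd a i j e x
    stay strict = record
      { hi = fin⁺ x ; x≤hi = ≤⁺-refl ; hi≤g = hi
      ; excess = λ k le → let r , eq , r≢0 = strict k le in
          r , eq , neither r≢0 (λ { (fin≤ q) → +suc≰ x k q }) }

    only-suc : g e ≡ fin⁺ (ℤ.suc x) → ∀ k → fin⁺ (x ℤ.+ + suc k) ≤⁺ g e → x ℤ.+ + suc k ≡ ℤ.suc x
    only-suc g≡ k le with subst (_ ≤⁺_) g≡ le
    ... | fin≤ q = ℤP.≤-antisym q (suc≤+suc x k)

    flat : ∀ {d} → i ℕ.+ d ≡ j → sat a e x ≡ 0 → RightEnd a i j e x
    flat {suc d} refl s = stay λ k _ → _ , cost-right a i (suc d) e x (suc k) s ,
      m+n≢0 (sat a e (x ℤ.+ + suc k)) λ ()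
    flat {zero} refl s with unsaturated a e hi s
    ... | h , x≤h , h≤g , iff = record
      { hi = h ; x≤hi = x≤h ; hi≤g = h≤g
      ; excess = λ k le → _ , trans (cost-right a i 0 e x (suc k) s)
          (cong (λ r → cost a i (i ℕ.+ 0) e x ℤ.+ + r) (ℕP.+-identityʳ _)) , iff _ le }

    steep : i ℕ.≤ suc j → sat a e x ≡ 0 → sat a e (ℤ.suc x) ≡ 1 → g e ≡ fin⁺ (ℤ.suc x) →
            RightEnd a i j e x
    steep i≤ s s′ g≡ with ℕP.m≤n⇒m<n∨m≡n i≤
    ... | inj₁ i<sj with ℕP.m≤n⇒∃[o]m+o≡n (ℕ.s≤s⁻¹ i<sj)
    ...   | d , refl = stay λ k le → _ , cost-right a i d e x (suc k) s , λ eq →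
            case trans (sym s′) (subst (λ w → sat a e w ≡ 0) (only-suc g≡ k le)
                  (ℕP.m+n≡0⇒m≡0 (sat a e (x ℤ.+ + suc k)) eq)) of λ ()
    steep i≤ s s′ g≡ | inj₂ refl = record
      { hi = g e ; x≤hi = hi ; hi≤g = ≤⁺-refl
      ; excess = λ k le → 0 , level k le , both refl le }
      where
      ring : ∀ J x → 1ℤ ℤ.+ (J ℤ.- (1ℤ ℤ.+ J)) ℤ.* (1ℤ ℤ.+ x) ≡
             (0ℤ ℤ.+ (J ℤ.- (1ℤ ℤ.+ J)) ℤ.* x) ℤ.+ 0ℤ
      ring = solve-∀
      level : ∀ k → fin⁺ (x ℤ.+ + suc k) ≤⁺ g e →
              cost a (suc j) j e (x ℤ.+ + suc k) ≡ cost a (suc j) j e x ℤ.+ + 0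
      level k le rewrite (only-suc g≡ k le) | s | s′ = ring (+ j) x

    byCap : Dec (fin⁺ (ℤ.suc x) ≤⁺ g e) → RightEnd a i j e x
    byCap (no ≰g) = stay λ k le → contradiction (≤⁺-trans (fin≤ (suc≤+suc x k)) le) ≰g
    byCap (yes le) with sat-cases a e (ℤ.suc x)
    ... | inj₁ s′ = flat (proj₂ (ℕP.m≤n⇒∃[o]m+o≡n (subst (λ c → i ℕ.≤ c ℕ.+ j) s′ (up le)))) (sat-below a x le)
    ... | inj₂ (s′ , g≡) = steep (subst (λ c → i ℕ.≤ c ℕ.+ j) s′ (up le)) (sat-below a x le) s′ g≡

  -- From an uncharged x each unit down costs i - j, so the optimal values reach f e if i = j and
  -- end at x otherwise. From a saturated x the charge is saved once: the first step down is free
  -- exactly when i = j + 1, and no further one is.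
  leftEnd : ∀ {a i j e x} → Kilter a i j e x → LeftEnd a i j e x
  leftEnd {a} {i} {j} {e} {x} K = byCap (f e ≤₋? fin₋ (ℤ.pred x))
    where
    open Kilter K
    stay : (∀ k {w} → x ≡ w ℤ.+ + suc k → f e ≤₋ fin₋ w → ∃ λ r →
             cost a i j e w ≡ cost a i j e x ℤ.+ + r × r ≢ 0) →
           LeftEnd a i j e x
    stay strict = record
      { lo = fin₋ x ; f≤lo = lo ; lo≤x = ≤₋-refl
      ; excess = λ { k {w} refl le → let r , eq , r≢0 = strict k refl le in
          r , eq , neither r≢0 (λ { (fin≤ q) → +suc≰ w k q }) } }

    below-x : ∀ k {w} → x ≡ w ℤ.+ + suc k → sat a e w ≡ 0
    below-x k {w} refl = sat-below a w (≤⁺-trans (fin≤ (suc≤+suc w k)) hi)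

    flat : ∀ {d} → j ℕ.+ d ≡ i → sat a e x ≡ 0 → LeftEnd a i j e x
    flat {d} refl s = choose d refl
      where
      level : ∀ k {w} → x ≡ w ℤ.+ + suc k →
              cost a (j ℕ.+ d) j e w ≡ cost a (j ℕ.+ d) j e x ℤ.+ + (d ℕ.* suc k)
      level k {w} refl = trans (sym (ℤP.+-identityʳ _))
        (trans (cong (λ c → cost a (j ℕ.+ d) j e w ℤ.+ + c) (sym s))
               (cost-left a j d e w (suc k) (below-x k refl)))
      choose : ∀ d′ → d ≡ d′ → LeftEnd a (j ℕ.+ d) j e x
      choose zero refl = record
        { lo = f e ; f≤lo = ≤₋-refl ; lo≤x = lo
        ; excess = λ k eq le → 0 , level k eq , both refl le }
      choose (suc _) refl = stay λ k eq _ → _ , level k eq , λ ()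

    steep : ∀ {d} → j ℕ.+ suc d ≡ i → f e ≤₋ fin₋ (ℤ.pred x) → sat a e x ≡ 1 → LeftEnd a i j e x
    steep {d} refl le s = choose d refl
      where
      -- The excess is `suc d` times `suc k`, less the one unit of charge saved.
      level : ∀ k {w} → x ≡ w ℤ.+ + suc k →
              cost a (j ℕ.+ suc d) j e w ≡ cost a (j ℕ.+ suc d) j e x ℤ.+ + (k ℕ.+ d ℕ.* suc k)
      level k {w} refl = ∙-cancelʳ 1ℤ (C w) (C x ℤ.+ + r)
        (trans (cong (λ c → C w ℤ.+ + c) (sym s))
        (trans (cost-left a j (suc d) e w (suc k) (below-x k refl)) (ring (C x) (+ r))))
        where
        C = cost a (j ℕ.+ suc d) j e
        r = k ℕ.+ d ℕ.* suc k
        ring : ∀ B R → B ℤ.+ (1ℤ ℤ.+ R) ≡ (B ℤ.+ R) ℤ.+ 1ℤ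
        ring = solve-∀
      choose : ∀ d′ → d ≡ d′ → LeftEnd a (j ℕ.+ suc d) j e x
      choose zero refl = record
        { lo = fin₋ (ℤ.pred x) ; f≤lo = le ; lo≤x = fin≤ (ℤP.i≤j⇒pred[i]≤j ℤP.≤-refl)
        ; excess = λ k eq _ → k ℕ.+ 0 , level k eq , next k eq }
        where
        next : ∀ k {w} → x ≡ w ℤ.+ + suc k → k ℕ.+ 0 ≡ 0 ⇔ fin₋ (ℤ.pred x) ≤₋ fin₋ w
        next zero    {w} refl = both refl (fin≤ (ℤP.≤-reflexive (pred-+1 w)))
          where
          pred-+1 : ∀ w → (ℤ.- 1ℤ) ℤ.+ (w ℤ.+ 1ℤ) ≡ w
          pred-+1 = solve-∀
        next (suc k) {w} refl = neither (λ ()) λ { (fin≤ q) → +suc≰ w k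
            (subst (ℤ._≤ w) (pred-+2 w (+ k)) q) }
          where
          pred-+2 : ∀ w K → (ℤ.- 1ℤ) ℤ.+ (w ℤ.+ (1ℤ ℤ.+ (1ℤ ℤ.+ K))) ≡ w ℤ.+ (1ℤ ℤ.+ K)
          pred-+2 = solve-∀
      choose (suc _) refl = stay λ k eq _ → _ , level k eq , m+n≢0 k λ ()

    byCap : Dec (f e ≤₋ fin₋ (ℤ.pred x)) → LeftEnd a i j e x
    byCap (no ≰x) = stay λ { k {w} refl le → contradiction
      (≤₋-trans le (fin≤ (ℤP.i<j⇒i≤pred[j] (ℤP.suc[i]≤j⇒i<j (suc≤+suc w k))))) ≰x }
    byCap (yes le) with sat-cases a e x
    ... | inj₁ s = flat (proj₂ (ℕP.m≤n⇒∃[o]m+o≡n (subst (λ c → c ℕ.+ j ℕ.≤ i) s (down le)))) s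
    ... | inj₂ (s , _) = 
      let d , eq = ℕP.m≤n⇒∃[o]m+o≡n (subst (λ c → c ℕ.+ j ℕ.≤ i) s (down le))
      in steep (trans (ℕP.+-suc j d) eq) le s

  record Box (a : Bool) (i j : ℕ) (e : Fin m) (x : ℤ) : Set where
    field
      lo    : ℤ₋
      hi    : ℤ⁺
      f≤lo  : f e ≤₋ lo
      lo≤hi : lo ≤₋⁺ hi
      hi≤g  : hi ≤⁺ g e
      least : ∀ w → f e ≤₋ fin₋ w → fin⁺ w ≤⁺ g e → cost a i j e x ℤ.≤ cost a i j e w
      equal : ∀ w → f e ≤₋ fin₋ w → fin⁺ w ≤⁺ g e →
              cost a i j e x ≡ cost a i j e w ⇔ (lo ≤₋ fin₋ w × fin⁺ w ≤⁺ hi)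

  box : ∀ {a i j e x} → Kilter a i j e x → Box a i j e x
  box {a} {i} {j} {e} {x} K = record
    { lo = L.lo ; hi = R.hi ; f≤lo = L.f≤lo ; lo≤hi = through L.lo≤x R.x≤hi ; hi≤g = R.hi≤g
    ; least = λ w f≤w w≤g → let r , eq , _ = excess w f≤w w≤g in
        subst (cost a i j e x ℤ.≤_) (sym eq) (ℤP.i≤i+j _ (+ r))
    ; equal = λ w f≤w w≤g → let r , eq , iff = excess w f≤w w≤g in mk⇔
        (λ same → to iff (ℤP.+-injective (∙-cancelˡ (cost a i j e x) (+ r) 0ℤ
                    (trans (sym eq) (trans (sym same) (sym (ℤP.+-identityʳ _)))))))
        (λ inside → sym (trans eq (trans (cong (λ r → cost a i j e x ℤ.+ + r) (from iff inside))
                    (ℤP.+-identityʳ _))))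
    }
    where
    module L = LeftEnd (leftEnd K)
    module R = RightEnd (rightEnd K)
    through : ∀ {l y h} → l ≤₋ fin₋ y → fin⁺ y ≤⁺ h → l ≤₋⁺ h
    through -∞≤      _        = -∞≤
    through (fin≤ _) ≤+∞      = ≤+∞
    through (fin≤ q) (fin≤ r) = fin≤ (ℤP.≤-trans q r)
    excess : ∀ w → f e ≤₋ fin₋ w → fin⁺ w ≤⁺ g e → ∃ λ r →
             cost a i j e w ≡ cost a i j e x ℤ.+ + r × (r ≡ 0 ⇔ (L.lo ≤₋ fin₋ w × fin⁺ w ≤⁺ R.hi))
    excess w f≤w w≤g with ℤP.<-cmp w x
    ... | tri≈ _ refl _ = 0 , sym (ℤP.+-identityʳ _) , both refl (L.lo≤x , R.x≤hi)
    ... | tri< w<x _ _ =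
      let k , x≡ = sub-decompose w<x
          r , eq , iff = L.excess k x≡ f≤w
      in r , eq , mk⇔ (λ r≡0 → to iff r≡0 , ≤⁺-trans (fin≤ (ℤP.<⇒≤ w<x)) R.x≤hi) (from iff ∘ proj₁)
    ... | tri> _ _ x<w with sub-decompose x<w
    ...   | k , refl =
      let r , eq , iff = R.excess k w≤g
      in r , eq , mk⇔ (λ r≡0 → ≤₋-trans L.lo≤x (fin≤ (ℤP.<⇒≤ x<w)) , to iff r≡0) (from iff ∘ proj₂)

  -- Duality between flows and potentials

  tension : (Fin n → ℕ) → Fin m → ℤ
  tension π e = + π (head D e) ℤ.- + π (tail D e)

  -- Summation by parts: exchanging the sums over vertices and edges turns inflow weighted by π into
  -- flow weighted by potential differences.
  dot-ψ : ∀ π z → dot π (ψℤ z) ≡ sum (λ e → tension π e ℤ.* z e)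
  dot-ψ π z = begin
    dot π (ψℤ z)
      ≡⟨ sum-cong-≗ (λ v → distrib (+ π v) (S (head D) v) (S (tail D) v)) ⟩
    sum (λ v → + π v ℤ.* S (head D) v ℤ.- + π v ℤ.* S (tail D) v)
      ≡⟨ sum-distrib-- (λ v → + π v ℤ.* S (head D) v) (λ v → + π v ℤ.* S (tail D) v) ⟩
    dot π (S (head D)) ℤ.- dot π (S (tail D))
      ≡⟨ cong₂ ℤ._-_ (swap (head D)) (swap (tail D)) ⟩
    sum (λ e → + π (head D e) ℤ.* z e) ℤ.- sum (λ e → + π (tail D e) ℤ.* z e)
      ≡⟨ sum-distrib-- (λ e → + π (head D e) ℤ.* z e) (λ e → + π (tail D e) ℤ.* z e) ⟨
    sum (λ e → + π (head D e) ℤ.* z e ℤ.- + π (tail D e) ℤ.* z e)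
      ≡⟨ sum-cong-≗ (λ e → factor (+ π (head D e)) (+ π (tail D e)) (z e)) ⟩
    sum (λ e → tension π e ℤ.* z e) ∎
    where
    open ≡-Reasoning
    S : (Fin m → Fin n) → Fin n → ℤ
    S end v = sum (λ e → ind (end e) v (z e))
    distrib : ∀ a b c → a ℤ.* (b ℤ.- c) ≡ a ℤ.* b ℤ.- a ℤ.* c
    distrib = solve-∀
    factor : ∀ a b c → a ℤ.* c ℤ.- b ℤ.* c ≡ (a ℤ.- b) ℤ.* c
    factor = solve-∀
    swap : ∀ end → dot π (S end) ≡ sum (λ e → + π (end e) ℤ.* z e)
    swap end = begin
      dot π (S end)
        ≡⟨ sum-cong-≗ (λ v → *-distribˡ-sum (+ π v) (λ e → ind (end e) v (z e))) ⟩
      sum (λ v → sum (λ e → + π v ℤ.* ind (end e) v (z e)))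
        ≡⟨ ∑-comm (λ v e → + π v ℤ.* ind (end e) v (z e)) ⟩
      sum (λ e → dot π (λ v → ind (end e) v (z e)))
        ≡⟨ sum-cong-≗ (λ e → dot-ind π (end e) (z e)) ⟩
      sum (λ e → + π (end e) ℤ.* z e) ∎

  -- By Abel summation it suffices to compare sums over upper level sets. These are the common total
  -- minus sums over lower level sets, where y attains the lower bound p.
  valid : ∀ {π y} → InBase y → Levels π y → ∀ x → InB' p x →
          (λ v → toℚ (+ π v)) · x ℚ.≤ toℚ (dot π y)
  valid {π} {y} b lev x x∈B = subst (_ ℚ.≤_) (dot-toℚ π λ _ → refl)
    (dot-mono-upper (proj₁ (bounded π)) π x (toℚ ∘ y) (proj₂ (bounded π)) upper)
    where
    above : (Fin n → ℚ) → ℕ → ℚ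
    above x k = sumℚ (λ v → if k ℕ.<ᵇ π v then x v else 0ℚ)
    <ᵇ-suc : ∀ a k → (a ℕ.<ᵇ suc k) ≡ not (k ℕ.<ᵇ a)
    <ᵇ-suc zero    k       = refl
    <ᵇ-suc (suc a) zero    = refl
    <ᵇ-suc (suc a) (suc k) = <ᵇ-suc a k
    split : ∀ x k → x̃ x (below π (suc k)) ℚ.+ above x k ≡ x̃ x ⊤
    split x k = trans (sym (sumℚ-distrib-+ (λ v → if lookup (below π (suc k)) v then x v else 0ℚ)
                                           (λ v → if k ℕ.<ᵇ π v then x v else 0ℚ))) (sumℚ-cong λ v →
      trans (cong (λ b → (if b then x v else 0ℚ) ℚ.+ (if k ℕ.<ᵇ π v then x v else 0ℚ))
              (trans (lookup∘tabulate (λ v → π v ℕ.<ᵇ suc k) v) (<ᵇ-suc (π v) k)))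
        (trans (cell (k ℕ.<ᵇ π v) (x v))
               (cong (λ b → if b then x v else 0ℚ) (sym ([]=⇒lookup {i = v} ∈⊤)))))
      where
      cell : ∀ b q → (if not b then q else 0ℚ) ℚ.+ (if b then q else 0ℚ) ≡ q
      cell true  q = ℚP.+-identityˡ q
      cell false q = ℚP.+-identityʳ q
    total : x̃ x ⊤ ≡ x̃ (toℚ ∘ y) ⊤
    total with InB'.total x∈B
    ... | t rewrite InBase.total b with t
    ...   | fin≡ eq = trans (sym eq) (sym (x̃-toℚ y ⊤))
    lower : ∀ k → x̃ (toℚ ∘ y) (below π k) ℚ.≤ x̃ x (below π k)
    lower k with lower-all x∈B (below π k)
    ... | l rewrite lev k with l
    ...   | fin≤ q = subst (ℚ._≤ _) (sym (x̃-toℚ y (below π k))) q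
    upper : ∀ k → above x k ℚ.≤ above (toℚ ∘ y) k
    upper k = ℚP.≮⇒≥ λ lt → ℚP.<-irrefl
      (trans (split (toℚ ∘ y) k) (trans (sym total) (sym (split x k))))
      (ℚP.+-mono-≤-< (lower (suc k)) lt)

  ≤₋ℚ-toℚ : ∀ {a x} → a ≤₋ℚ toℚ x ⇔ a ≤₋ fin₋ x
  ≤₋ℚ-toℚ = mk⇔ (λ { -∞≤ → -∞≤ ; (fin≤ q) → fin≤ (toℚ-cancel-≤ q) })
                (λ { -∞≤ → -∞≤ ; (fin≤ q) → fin≤ (toℚ-mono-≤ q) })

  ℚ≤⁺-toℚ : ∀ {a x} → toℚ x ℚ≤⁺ a ⇔ fin⁺ x ≤⁺ a
  ℚ≤⁺-toℚ = mk⇔ (λ { ≤+∞ → ≤+∞ ; (fin≤ q) → fin≤ (toℚ-cancel-≤ q) })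
                (λ { ≤+∞ → ≤+∞ ; (fin≤ q) → fin≤ (toℚ-mono-≤ q) })

  -- Minimizers as the flows attaining equality

  module _ (L : Subset m) (opt : ∃ λ π → ∃ (Optimal (lookup L) π)) where
    π = proj₁ opt
    z* = proj₁ (proj₂ opt)
    open Optimal (proj₂ (proj₂ opt))

    boxOf : ∀ e → Box (lookup L e) (π (tail D e)) (π (head D e)) e (z* e)
    boxOf e = box (kilter e)

    potential : Fin n → ℚ
    potential v = toℚ (+ π v)

    maximum : ℚ
    maximum = toℚ (dot π (ψℤ z*))

    Face : (Fin n → ℚ) → Set
    Face x = InB' p x × (potential · x) ≡ maximum

    costs : (Fin m → ℤ) → Fin m → ℤ
    costs z e = cost (lookup L e) (π (tail D e)) (π (head D e)) e (z e)

    sum-costs : ∀ z → sum (costs z) ≡ + satCount g L z ℤ.+ dot π (ψℤ z)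
    sum-costs z = trans (∑-distrib-+ (λ e → + sat (lookup L e) e (z e)) (λ e → tension π e ℤ.* z e))
      (cong₂ ℤ._+_ (sym (+sumℕ λ e → sat (lookup L e) e (z e))) (sym (dot-ψ π z)))

    module _ z (z∈Q : InQℤ D f g (InB' p) z) where

      costs-least : ∀ e → costs z* e ℤ.≤ costs z e
      costs-least e = Box.least (boxOf e) (z e) (to ≤₋ℚ-toℚ (proj₁ z∈Q e)) (to ℚ≤⁺-toℚ (proj₁ (proj₂ z∈Q) e))

      costs-equal : ∀ e → costs z* e ≡ costs z e ⇔
                    (Box.lo (boxOf e) ≤₋ fin₋ (z e) × fin⁺ (z e) ≤⁺ Box.hi (boxOf e))
      costs-equal e = Box.equal (boxOf e) (z e) (to ≤₋ℚ-toℚ (proj₁ z∈Q e)) (to ℚ≤⁺-toℚ (proj₁ (proj₂ z∈Q) e))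

      dot-least : dot π (ψℤ z) ℤ.≤ dot π (ψℤ z*)
      dot-least = toℚ-cancel-≤ (subst (ℚ._≤ maximum) (dot-toℚ π (ψ-toℚ z))
        (valid base levels (ψ D (toℚ ∘ z)) (proj₂ (proj₂ z∈Q))))

      weak-duality : + satCount g L z* ℤ.+ dot π (ψℤ z*) ℤ.≤ + satCount g L z ℤ.+ dot π (ψℤ z)
      weak-duality = subst₂ ℤ._≤_ (sum-costs z*) (sum-costs z) (sum-mono-≤ costs-least)

    z*∈Q : InQℤ D f g (InB' p) z*
    z*∈Q = (λ e → from ≤₋ℚ-toℚ (Kilter.lo (kilter e))) , (λ e → from ℚ≤⁺-toℚ (Kilter.hi (kilter e))) ,
           toB' (ψ-toℚ z*) base

    characterisation : ∀ z → InQℤ D f g (InB' p) z →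
      IsUpperMin D f g (InB' p) L z ⇔ InQℤ D (Box.lo ∘ boxOf) (Box.hi ∘ boxOf) Face z
    characterisation z z∈Q = mk⇔ only-if if
      where
      only-if : IsUpperMin D f g (InB' p) L z → InQℤ D (Box.lo ∘ boxOf) (Box.hi ∘ boxOf) Face z
      only-if (_ , min) =
        (λ e → from ≤₋ℚ-toℚ (proj₁ (inside e))) , (λ e → from ℚ≤⁺-toℚ (proj₂ (inside e))) ,
        proj₂ (proj₂ z∈Q) ,
        trans (dot-toℚ π (ψ-toℚ z)) (cong toℚ (ℤP.≤-antisym (dot-least z z∈Q) dot-greatest))
        where
        sat≤ : + satCount g L z ℤ.≤ + satCount g L z*
        sat≤ = ℤ.+≤+ (min z* z*∈Q)
        dot-greatest : dot π (ψℤ z*) ℤ.≤ dot π (ψℤ z)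
        -- A smaller value, with no more saturated edges than z*, would violate weak duality.
        dot-greatest = ℤP.≮⇒≥ λ lt → ℤP.<⇒≱ (ℤP.+-mono-≤-< sat≤ lt) (weak-duality z z∈Q)
        inside : ∀ e → Box.lo (boxOf e) ≤₋ fin₋ (z e) × fin⁺ (z e) ≤⁺ Box.hi (boxOf e)
        -- The total cost of z does not exceed that of z*, so the edgewise inequalities are all
        -- equalities.
        inside e = to (costs-equal z z∈Q e) (sum-≤⇒≗ (costs-least z z∈Q)
          (subst₂ ℤ._≤_ (sym (sum-costs z)) (sym (sum-costs z*)) (ℤP.+-mono-≤ sat≤ (dot-least z z∈Q))) e)
      if : InQℤ D (Box.lo ∘ boxOf) (Box.hi ∘ boxOf) Face z → IsUpperMin D f g (InB' p) L z
      -- By `attained`, z has the total cost of z*. A flow w with fewer saturated edges, whose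
      -- π-value is at most that of z*, would have a smaller total.
      if (lo≤z , z≤hi , _ , on-face) = z∈Q , λ w w∈Q → ℤP.drop‿+≤+ (ℤP.≮⇒≥ λ lt →
        ℤP.<⇒≱ (ℤP.+-mono-<-≤ lt (dot-least w w∈Q))
          (subst (ℤ._≤ _) attained (weak-duality w w∈Q)))
        where
        same-dot : dot π (ψℤ z) ≡ dot π (ψℤ z*)
        same-dot = toℚ-injective (trans (sym (dot-toℚ π (ψ-toℚ z))) on-face)
        attained : + satCount g L z* ℤ.+ dot π (ψℤ z*) ≡ + satCount g L z ℤ.+ dot π (ψℤ z*)
        attained = trans (sym (sum-costs z*)) (trans
          (sum-cong-≗ λ e → from (costs-equal z z∈Q e) (to ≤₋ℚ-toℚ (lo≤z e) , to ℚ≤⁺-toℚ (z≤hi e)))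
          (trans (sum-costs z) (cong (ℤ._+_ (+ satCount g L z)) same-dot)))

theorem2p1 : ∀ {n m : ℕ} (D : Digraph n m)
    (f : Fin m → ℤ₋) (g : Fin m → ℤ⁺) → (∀ e → f e ≤₋⁺ g e) →
    (p : Subset n → ℤ₋) → IsSupermodular p →
    Σ (Fin m → ℤ) (λ z₀ → InQℤ D f g (InB' p) z₀) →
    (L : Subset m) → FiniteOn L f g →
    Σ ((Fin n → ℚ) → Set) λ BL → Σ (Fin m → ℤ₋) λ fL → Σ (Fin m → ℤ⁺) λ gL →
    IsFace (InB' p) BL ×
    (∀ e → f e ≤₋ fL e) × (∀ e → fL e ≤₋⁺ gL e) × (∀ e → gL e ≤⁺ g e) ×
    (∀ z → InQℤ D f g (InB' p) z →
    (IsUpperMin D f g (InB' p) L z ⇔ InQℤ D fL gL BL z))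
theorem2p1 D f g _ p supermodular (z₀ , f≤z₀ , z₀≤g , z₀∈B) L _ =
  Face L opt , Box.lo ∘ boxOf L opt , Box.hi ∘ boxOf L opt ,
  (potential L opt , maximum L opt , valid base levels , λ _ → mk⇔ (λ x → x) (λ x → x)) ,
  Box.f≤lo ∘ boxOf L opt , Box.lo≤hi ∘ boxOf L opt , Box.hi≤g ∘ boxOf L opt ,
  characterisation L opt
  where
  open Base p supermodular
  open Flow D f g p supermodular
  opt : ∃ λ π → ∃ (Optimal (lookup L) π)
  opt = solve (lookup L) (z₀ , start z₀ (to ≤₋ℚ-toℚ ∘ f≤z₀) (to ℚ≤⁺-toℚ ∘ z₀≤g)
                                 (fromB' (ψ-toℚ z₀) z₀∈B))
  open Optimal (proj₂ (proj₂ opt))
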